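{- For every real $\epsilon>0$ and every integer $r\ge 1$ there is a real $\delta>0$ such that the following holds. Let $G$ be an $r$-graph and let $x\ge r$ be a real number with $|G|=\binom{x}{r}$. If $K^r_{r+1}(G)>(1-\delta)\binom{x}{r+1}$, then there is a set $S\subset V(G)$ of $\lceil x\rceil$ vertices such that all but at most $\epsilon\binom{x}{r}$ edges of $G$ are contained in $S$.
   Context: An $r$-graph $G$ consists of a finite vertex set $V(G)$ and a set $E(G)$ of edges, each edge being an $r$-element subset of $V(G)$; $|G|=|E(G)|$. $K^r_{r+1}(G)$ denotes the number of copies of $K^r_{r+1}$ in $G$, i.e. the number of $(r+1)$-element subsets of $V(G)$ all of whose $r$-element subsets are edges of $G$. For real $x$ and integer $k\ge 0$, $\binom{x}{k}=x(x-1)\cdots(x-k+1)/k!$. -}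

module Defs where

open import Data.Fin.Subset
  using (Subset; inside; outside; _⊆_; ∣_∣)
open import Data.Fin.Subset.Properties using (_⊆?_; anySubset?)
open import Data.Integer.Base using (+_)
open import Data.List.Base using (List; []; _∷_; _++_; map; filter; length)
import Data.Nat.Base as ℕ
open ℕ using (ℕ; zero; suc; _!)
import Data.Nat.Properties as ℕ
open import Data.Product.Base using (∃-syntax; _×_; _,_)
import Data.Rational.Base as ℚ
open ℚ using (ℚ; 0ℚ; 1ℚ; ½)
import Data.Rational.Properties as ℚ
open import Data.Rational.Solver using (module +-*-Solver)
open import Data.Vec.Base as Vec using ()
open import Relation.Binary.PropositionalEquality
  using (_≡_; refl; sym; trans; cong; cong₂; subst)
open import Relation.Nullary using (Dec; yes; no; ¬?)
open import Relation.Nullary.Decidable using (_×-dec_; decidable-stable)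
open import Relation.Unary using (Pred; Decidable)
open import Level using (0ℓ)

infixl 7 _*_
infixl 6 _-_
infix  4 _≃_ _≤_ _<_

-- Real numbers as Cauchy sequences of rationals, compared by _≃_ below
-- rather than by propositional equality.

IsCauchy : (ℕ → ℚ) → Set
IsCauchy x = ∀ ε → 0ℚ ℚ.< ε →
  ∃[ N ] (∀ {m n} → N ℕ.≤ m → N ℕ.≤ n → ℚ.∣ x m ℚ.- x n ∣ ℚ.≤ ε)

record ℝ : Set where
  constructor mkℝ
  field
    approx : ℕ → ℚ
    cauchy : IsCauchy approx

open ℝ public

_≃_ : ℝ → ℝ → Set
x ≃ y = ∀ ε → 0ℚ ℚ.< ε →
  ∃[ N ] (∀ {n} → N ℕ.≤ n → ℚ.∣ approx x n ℚ.- approx y n ∣ ℚ.≤ ε)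

_≤_ : ℝ → ℝ → Set
x ≤ y = ∀ ε → 0ℚ ℚ.< ε →
  ∃[ N ] (∀ {n} → N ℕ.≤ n → approx x n ℚ.≤ approx y n ℚ.+ ε)

_<_ : ℝ → ℝ → Set
x < y = ∃[ ε ] 0ℚ ℚ.< ε ×
  ∃[ N ] (∀ {n} → N ℕ.≤ n → approx x n ℚ.+ ε ℚ.≤ approx y n)

fromℚ : ℚ → ℝ
fromℚ q = mkℝ (λ _ → q) λ ε 0<ε → 0 , λ _ _ →
  subst (λ d → ℚ.∣ d ∣ ℚ.≤ ε) (sym (ℚ.+-inverseʳ q)) (ℚ.<⇒≤ 0<ε)

fromℕ : ℕ → ℝ
fromℕ n = fromℚ (+ n ℚ./ 1)

0ℝ 1ℝ : ℝ
0ℝ = fromℕ 0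
1ℝ = fromℕ 1

private
  minus-regroup : ∀ a b c d →
    (a ℚ.- b) ℚ.- (c ℚ.- d) ≡ (a ℚ.- c) ℚ.- (b ℚ.- d)
  minus-regroup = solve 4 (λ a b c d →
    (a :- b) :- (c :- d) := (a :- c) :- (b :- d)) refl
    where open +-*-Solver

  add-sub : ∀ a b → a ≡ (a ℚ.- b) ℚ.+ b
  add-sub = solve 2 (λ a b → a := (a :- b) :+ b) refl
    where open +-*-Solver

  times-regroup : ∀ a b c d →
    a ℚ.* b ℚ.- c ℚ.* d ≡ a ℚ.* (b ℚ.- d) ℚ.+ d ℚ.* (a ℚ.- c)
  times-regroup = solve 4 (λ a b c d →
    a :* b :- c :* d := a :* (b :- d) :+ d :* (a :- c)) refl
    where open +-*-Solver

  half : ∀ {ε} → 0ℚ ℚ.< ε → 0ℚ ℚ.< ½ ℚ.* ε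
  half 0<ε = ℚ.*-monoʳ-<-pos ½ 0<ε

  halves : ∀ ε → ½ ℚ.* ε ℚ.+ ½ ℚ.* ε ≡ ε
  halves ε = trans (sym (ℚ.*-distribʳ-+ ε ½ ½)) (ℚ.*-identityˡ ε)

  minus-cauchy : ∀ {x y} → IsCauchy x → IsCauchy y →
             IsCauchy (λ n → x n ℚ.- y n)
  minus-cauchy {x} {y} cx cy ε 0<ε with cx _ (half 0<ε) | cy _ (half 0<ε)
  ... | M , hx | N , hy = M ℕ.⊔ N , λ {m} {n} p q → begin
    ℚ.∣ (x m ℚ.- y m) ℚ.- (x n ℚ.- y n) ∣
      ≡⟨ cong ℚ.∣_∣ (minus-regroup (x m) (y m) (x n) (y n)) ⟩
    ℚ.∣ (x m ℚ.- x n) ℚ.- (y m ℚ.- y n) ∣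
      ≤⟨ ℚ.∣p-q∣≤∣p∣+∣q∣ (x m ℚ.- x n) (y m ℚ.- y n) ⟩
    ℚ.∣ x m ℚ.- x n ∣ ℚ.+ ℚ.∣ y m ℚ.- y n ∣
      ≤⟨ ℚ.+-mono-≤ (hx (ℕ.m⊔n≤o⇒m≤o M N p) (ℕ.m⊔n≤o⇒m≤o M N q))
                    (hy (ℕ.m⊔n≤o⇒n≤o M N p) (ℕ.m⊔n≤o⇒n≤o M N q)) ⟩
    ½ ℚ.* ε ℚ.+ ½ ℚ.* ε
      ≡⟨ halves ε ⟩
    ε ∎
    where open ℚ.≤-Reasoning

  bounded : ∀ {x} → IsCauchy x → ∃[ B ] 0ℚ ℚ.< B ×
    ∃[ N ] (∀ {n} → N ℕ.≤ n → ℚ.∣ x n ∣ ℚ.≤ B)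
  bounded {x} cx with cx 1ℚ (ℚ.positive⁻¹ 1ℚ)
  ... | N , h = 1ℚ ℚ.+ ℚ.∣ x N ∣ ,
                ℚ.+-mono-<-≤ (ℚ.positive⁻¹ 1ℚ) (ℚ.0≤∣p∣ (x N)) ,
                N , λ {n} p → begin
    ℚ.∣ x n ∣
      ≡⟨ cong ℚ.∣_∣ (add-sub (x n) (x N)) ⟩
    ℚ.∣ (x n ℚ.- x N) ℚ.+ x N ∣
      ≤⟨ ℚ.∣p+q∣≤∣p∣+∣q∣ (x n ℚ.- x N) (x N) ⟩
    ℚ.∣ x n ℚ.- x N ∣ ℚ.+ ℚ.∣ x N ∣
      ≤⟨ ℚ.+-monoˡ-≤ ℚ.∣ x N ∣ (h p ℕ.≤-refl) ⟩
    1ℚ ℚ.+ ℚ.∣ x N ∣ ∎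
    where open ℚ.≤-Reasoning

  quotient : ∀ {B ε} → 0ℚ ℚ.< B → 0ℚ ℚ.< ε →
             ∃[ η ] 0ℚ ℚ.< η × B ℚ.* η ≡ ε
  quotient {B} {ε} 0<B 0<ε = 1/B ℚ.* ε , ℚ.positive⁻¹ _ ⦃ 0<η ⦄ , eq
    where
    instance _ = ℚ.positive 0<B
             _ = ℚ.positive 0<ε
             _ = ℚ.pos⇒nonZero B
             _ = ℚ.1/pos⇒pos B
    1/B = ℚ.1/ B
    0<η : ℚ.Positive (1/B ℚ.* ε)
    0<η = ℚ.pos*pos⇒pos 1/B ε
    eq : B ℚ.* (1/B ℚ.* ε) ≡ ε
    eq = trans (sym (ℚ.*-assoc B 1/B ε))
        (trans (cong (ℚ._* ε) (ℚ.*-inverseʳ B)) (ℚ.*-identityˡ ε))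

  times-bound : ∀ {p q B η} → ℚ.∣ p ∣ ℚ.≤ B → ℚ.∣ q ∣ ℚ.≤ η →
            ℚ.∣ p ℚ.* q ∣ ℚ.≤ B ℚ.* η
  times-bound {p} {q} {B} {η} p≤B q≤η = begin
    ℚ.∣ p ℚ.* q ∣         ≡⟨ ℚ.∣p*q∣≡∣p∣*∣q∣ p q ⟩
    ℚ.∣ p ∣ ℚ.* ℚ.∣ q ∣   ≤⟨ ℚ.*-monoʳ-≤-nonNeg ℚ.∣ q ∣ p≤B ⟩
    B ℚ.* ℚ.∣ q ∣         ≤⟨ ℚ.*-monoˡ-≤-nonNeg B q≤η ⟩
    B ℚ.* η               ∎
    where
    open ℚ.≤-Reasoning
    instance _ = ℚ.nonNegative (ℚ.0≤∣p∣ q)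
             _ = ℚ.nonNegative (ℚ.≤-trans (ℚ.0≤∣p∣ p) p≤B)

  times-step : ∀ {a b c d B C η θ} →
    ℚ.∣ a ∣ ℚ.≤ B → ℚ.∣ b ℚ.- d ∣ ℚ.≤ η →
    ℚ.∣ d ∣ ℚ.≤ C → ℚ.∣ a ℚ.- c ∣ ℚ.≤ θ →
    ℚ.∣ a ℚ.* b ℚ.- c ℚ.* d ∣ ℚ.≤ B ℚ.* η ℚ.+ C ℚ.* θ
  times-step {a} {b} {c} {d} {B} {C} {η} {θ} a≤ b≤ d≤ c≤ = begin
    ℚ.∣ a ℚ.* b ℚ.- c ℚ.* d ∣
      ≡⟨ cong ℚ.∣_∣ (times-regroup a b c d) ⟩
    ℚ.∣ a ℚ.* (b ℚ.- d) ℚ.+ d ℚ.* (a ℚ.- c) ∣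
      ≤⟨ ℚ.∣p+q∣≤∣p∣+∣q∣ (a ℚ.* (b ℚ.- d)) (d ℚ.* (a ℚ.- c)) ⟩
    ℚ.∣ a ℚ.* (b ℚ.- d) ∣ ℚ.+ ℚ.∣ d ℚ.* (a ℚ.- c) ∣
      ≤⟨ ℚ.+-mono-≤ (times-bound {a} {b ℚ.- d} {B} {η} a≤ b≤)
                    (times-bound {d} {a ℚ.- c} {C} {θ} d≤ c≤) ⟩
    B ℚ.* η ℚ.+ C ℚ.* θ ∎
    where open ℚ.≤-Reasoning

  times-cauchy : ∀ {x y} → IsCauchy x → IsCauchy y →
                 IsCauchy (λ n → x n ℚ.* y n)
  times-cauchy {x} {y} cx cy ε 0<ε =
    let B , 0<B , K , bx = bounded cx
        C , 0<C , L , by = bounded cy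
        η , 0<η , Bη = quotient 0<B (half 0<ε)
        θ , 0<θ , Cθ = quotient 0<C (half 0<ε)
        M , hx = cx θ 0<θ
        N , hy = cy η 0<η
    in (K ℕ.⊔ L) ℕ.⊔ (M ℕ.⊔ N) , λ {m} {n} p q →
    let p₁ = ℕ.m⊔n≤o⇒m≤o (K ℕ.⊔ L) (M ℕ.⊔ N) p
        p₂ = ℕ.m⊔n≤o⇒n≤o (K ℕ.⊔ L) (M ℕ.⊔ N) p
        q₁ = ℕ.m⊔n≤o⇒m≤o (K ℕ.⊔ L) (M ℕ.⊔ N) q
        q₂ = ℕ.m⊔n≤o⇒n≤o (K ℕ.⊔ L) (M ℕ.⊔ N) q
    in subst (ℚ.∣ x m ℚ.* y m ℚ.- x n ℚ.* y n ∣ ℚ.≤_)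
         (trans (cong₂ ℚ._+_ Bη Cθ) (halves ε))
         (times-step {x m} {y m} {x n} {y n} {B} {C} {η} {θ}
           (bx (ℕ.m⊔n≤o⇒m≤o K L p₁))
           (hy (ℕ.m⊔n≤o⇒n≤o M N p₂) (ℕ.m⊔n≤o⇒n≤o M N q₂))
           (by (ℕ.m⊔n≤o⇒n≤o K L q₁))
           (hx (ℕ.m⊔n≤o⇒m≤o M N p₂) (ℕ.m⊔n≤o⇒m≤o M N q₂)))

_-_ : ℝ → ℝ → ℝ
x - y = mkℝ (λ n → approx x n ℚ.- approx y n)
  (minus-cauchy {approx x} {approx y} (cauchy x) (cauchy y))

_*_ : ℝ → ℝ → ℝ
x * y = mkℝ (λ n → approx x n ℚ.* approx y n)
  (times-cauchy {approx x} {approx y} (cauchy x) (cauchy y))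

fallingFactorial : ℝ → ℕ → ℝ
fallingFactorial x zero    = 1ℝ
fallingFactorial x (suc k) = fallingFactorial x k * (x - fromℕ k)

binomial : ℝ → ℕ → ℝ
binomial x k = fallingFactorial x k * fromℚ (ℚ._/_ (+ 1) (k !) ⦃ k ℕ.!≢0 ⦄)

-- The order on ℝ is not decidable, so the ceiling is given as a relation:
-- n = ⌈ x ⌉ iff n - 1 < x ≤ n.
IsCeiling : ℝ → ℕ → Set
IsCeiling x n = (fromℕ n - 1ℝ) < x × x ≤ fromℕ n

allSubsets : ∀ n → List (Subset n)
allSubsets zero    = Vec.[] ∷ []
allSubsets (suc n) =
  map (inside Vec.∷_) (allSubsets n) ++ map (outside Vec.∷_) (allSubsets n)

count : ∀ {n} {P : Pred (Subset n) 0ℓ} → Decidable P → ℕ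
count {n} P? = length (filter P? (allSubsets n))

record Hypergraph (r : ℕ) : Set₁ where
  field
    order   : ℕ
    Edge    : Pred (Subset order) 0ℓ
    edge?   : Decidable Edge
    uniform : ∀ {e} → Edge e → ∣ e ∣ ≡ r

  size : ℕ
  size = count edge?

  -- T spans a copy of the complete r-graph on r + 1 vertices.
  IsClique : Pred (Subset order) 0ℓ
  IsClique T = ∣ T ∣ ≡ suc r × (∀ {e} → e ⊆ T → ∣ e ∣ ≡ r → Edge e)

  isClique? : Decidable IsClique
  isClique? T = (∣ T ∣ ℕ.≟ suc r) ×-dec full?
    where
    full? : Dec (∀ {e} → e ⊆ T → ∣ e ∣ ≡ r → Edge e)
    full? with anySubset? (λ e → (e ⊆? T) ×-dec ((∣ e ∣ ℕ.≟ r) ×-dec ¬? (edge? e)))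
    ... | yes (e , e⊆T , ∣e∣≡r , ¬Ee) = no λ full → ¬Ee (full e⊆T ∣e∣≡r)
    ... | no ¬missing = yes λ {e} e⊆T ∣e∣≡r →
      decidable-stable (edge? e) λ ¬Ee → ¬missing (e , e⊆T , ∣e∣≡r , ¬Ee)

  cliqueCount : ℕ
  cliqueCount = count isClique?

  edgesNotWithin : Subset order → ℕ
  edgesNotWithin S = count λ e → edge? e ×-dec ¬? (e ⊆? S)

-- Write r = k + 1, and let d(v) and K(v) count the edges and the (r+1)-cliques
-- through v. If |G| ≤ C(y,r) with y ≥ r, then r K(v) ≤ (y - r) d(v): when
-- d(v) < C(y-1,r-1), induct on the link of v, which has d(v) edges and at least
-- K(v) cliques; otherwise use K(v) ≤ |G| - d(v). Summing over v gives
-- (r+1) K ≤ (y - r) |G|, which closes the induction on r.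
--
-- If K is nearly extremal, the deficits D(v) = (y - r) d(v) - r K(v) ≥ 0 have
-- a small sum. With b = C(y-1,r-1), the second case above always gives
-- D(v) ≥ y (d(v) - b), and the link argument gives D(v) ≥ η y d(v) when
-- d(v) < C(y-ηy-1,r-1). So vertices of degree below C(y-ηy-1,r-1) ≈ b carry
-- few edges; there are at most about y other vertices, and those in excess of
-- ⌈x⌉ cost about b edges each. Hence S may be any ⌈x⌉-set nested with the set
-- of the other vertices.
--
-- The argument runs over ℚ, with y a close upper approximation of x, so that
-- only rational binomial coefficients occur, represented by falling factorials.
-- The ceiling of x is computable since C(x,r) is a natural number.
module Submission where

open import Defs using (Hypergraph; count; allSubsets)

-- Counting subsets, degrees and links

module Counting where

  open import Algebra.Properties.CommutativeSemigroup using (interchange)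
  import Algebra.Properties.Semiring.Sum
  open import Data.Bool.Base using (true; false; not; if_then_else_)
  open import Data.Fin.Base using (Fin; zero; suc)
  import Data.Fin.Properties as Fin
  open import Data.Fin.Subset
  open import Data.Fin.Subset.Properties
  open import Data.List.Base as List using (List; length; filter)
  open import Data.List.Properties using (filter-++; length-++)
  open import Data.Nat.Base
  open import Data.Nat.Properties
  open import Data.Product.Base using (∃-syntax; _×_; _,_; proj₂)
  open import Data.Vec.Base using ([]; _∷_; _[_]%=_; here; there)
  open import Function.Base using (_∘_)
  open import Level using (0ℓ)
  open import Relation.Binary.PropositionalEquality
  open import Relation.Nullary
  open import Relation.Nullary.Decidable using (_×-dec_; decidable-stable)
  open import Relation.Unary using (Pred; Decidable)

  open Algebra.Properties.Semiring.Sum +-*-semiring public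
    using (sum; ∑-distrib-+; sum-cong-≗)

  𝟙 : ∀ {A : Set} → Dec A → ℕ
  𝟙 d = if does d then 1 else 0

  𝟙-yes : ∀ {A : Set} (d : Dec A) → A → 𝟙 d ≡ 1
  𝟙-yes (yes _) _ = refl
  𝟙-yes (no ¬a) a = contradiction a ¬a

  𝟙≤ : ∀ {A : Set} {m} (d : Dec A) → (A → 1 ≤ m) → 𝟙 d ≤ m
  𝟙≤ (yes a) f = f a
  𝟙≤ (no _)  f = z≤n

  𝟙-mono : ∀ {A B : Set} (d : Dec A) (e : Dec B) → (A → B) → 𝟙 d ≤ 𝟙 e
  𝟙-mono d e f = 𝟙≤ d λ a → ≤-reflexive (sym (𝟙-yes e (f a)))

  𝟙-disjoint : ∀ {A B C : Set} (d : Dec A) (e : Dec B) (c : Dec C) →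
               (A → C) → (B → C) → (A → ¬ B) → 𝟙 d + 𝟙 e ≤ 𝟙 c
  𝟙-disjoint (no _)  e       c f g h = 𝟙-mono e c g
  𝟙-disjoint (yes a) (yes b) c f g h = contradiction b (h a)
  𝟙-disjoint (yes a) (no _)  c f g h = 𝟙-mono (yes a) c f

  -- The recursion mirrors that of `allSubsets`, so a `count` becomes a sum whose terms can be
  -- compared and whose order of summation can be exchanged.
  Σ⊆ : ∀ {n} → (Subset n → ℕ) → ℕ
  Σ⊆ {zero}  f = f []
  Σ⊆ {suc n} f = Σ⊆ (f ∘ (inside ∷_)) + Σ⊆ (f ∘ (outside ∷_))

  Σ⊆-mono : ∀ {n} {f g : Subset n → ℕ} → (∀ s → f s ≤ g s) → Σ⊆ f ≤ Σ⊆ g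
  Σ⊆-mono {zero}  h = h []
  Σ⊆-mono {suc n} h = +-mono-≤ (Σ⊆-mono (h ∘ (inside ∷_))) (Σ⊆-mono (h ∘ (outside ∷_)))

  Σ⊆-cong : ∀ {n} {f g : Subset n → ℕ} → (∀ s → f s ≡ g s) → Σ⊆ f ≡ Σ⊆ g
  Σ⊆-cong {zero}  h = h []
  Σ⊆-cong {suc n} h = cong₂ _+_ (Σ⊆-cong (h ∘ (inside ∷_))) (Σ⊆-cong (h ∘ (outside ∷_)))

  Σ⊆-distrib-+ : ∀ {n} (f g : Subset n → ℕ) → Σ⊆ (λ s → f s + g s) ≡ Σ⊆ f + Σ⊆ g
  Σ⊆-distrib-+ {zero}  f g = refl
  Σ⊆-distrib-+ {suc n} f g = trans
    (cong₂ _+_ (Σ⊆-distrib-+ (f ∘ (inside ∷_)) (g ∘ (inside ∷_)))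
               (Σ⊆-distrib-+ (f ∘ (outside ∷_)) (g ∘ (outside ∷_))))
    (interchange +-commutativeSemigroup (Σ⊆ (f ∘ (inside ∷_))) (Σ⊆ (g ∘ (inside ∷_)))
                 (Σ⊆ (f ∘ (outside ∷_))) (Σ⊆ (g ∘ (outside ∷_))))

  Σ⊆-distribˡ-* : ∀ {n} c (f : Subset n → ℕ) → Σ⊆ (λ s → c * f s) ≡ c * Σ⊆ f
  Σ⊆-distribˡ-* {zero}  c f = refl
  Σ⊆-distribˡ-* {suc n} c f = trans
    (cong₂ _+_ (Σ⊆-distribˡ-* c (f ∘ (inside ∷_))) (Σ⊆-distribˡ-* c (f ∘ (outside ∷_))))
    (sym (*-distribˡ-+ c (Σ⊆ (f ∘ (inside ∷_))) (Σ⊆ (f ∘ (outside ∷_)))))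

  sum-Σ⊆-comm : ∀ {m n} (f : Fin m → Subset n → ℕ) →
                sum (λ i → Σ⊆ (f i)) ≡ Σ⊆ (λ s → sum (λ i → f i s))
  sum-Σ⊆-comm {n = zero}  f = refl
  sum-Σ⊆-comm {n = suc n} f = trans
    (∑-distrib-+ (λ i → Σ⊆ (f i ∘ (inside ∷_))) (λ i → Σ⊆ (f i ∘ (outside ∷_))))
    (cong₂ _+_ (sum-Σ⊆-comm (λ i → f i ∘ (inside ∷_))) (sum-Σ⊆-comm (λ i → f i ∘ (outside ∷_))))

  private
    length-filter-map : ∀ {A B : Set} {P : Pred B 0ℓ} (P? : Decidable P) (f : A → B) xs →
                        length (filter P? (List.map f xs)) ≡ length (filter (P? ∘ f) xs)
    length-filter-map P? f List.[] = refl
    length-filter-map P? f (x List.∷ xs) with does (P? (f x))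
    ... | true  = cong suc (length-filter-map P? f xs)
    ... | false = length-filter-map P? f xs

  count≡Σ⊆ : ∀ {n} {P : Pred (Subset n) 0ℓ} (P? : Decidable P) →
             count P? ≡ Σ⊆ (𝟙 ∘ P?)
  count≡Σ⊆ {zero} P? with does (P? [])
  ... | true  = refl
  ... | false = refl
  count≡Σ⊆ {suc n} P? = begin
    length (filter P? (ins List.++ outs))
      ≡⟨ cong length (filter-++ P? ins outs) ⟩
    length (filter P? ins List.++ filter P? outs)
      ≡⟨ length-++ (filter P? ins) ⟩
    length (filter P? ins) + length (filter P? outs)
      ≡⟨ cong₂ _+_ (length-filter-map P? (inside ∷_) (allSubsets n))
                   (length-filter-map P? (outside ∷_) (allSubsets n)) ⟩
    count (P? ∘ (inside ∷_)) + count (P? ∘ (outside ∷_))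
      ≡⟨ cong₂ _+_ (count≡Σ⊆ (P? ∘ (inside ∷_))) (count≡Σ⊆ (P? ∘ (outside ∷_))) ⟩
    Σ⊆ (𝟙 ∘ P?) ∎
    where
    open ≡-Reasoning
    ins  = List.map (inside ∷_) (allSubsets n)
    outs = List.map (outside ∷_) (allSubsets n)

  count-mono : ∀ {n} {P Q : Pred (Subset n) 0ℓ} (P? : Decidable P) (Q? : Decidable Q) →
               (∀ {s} → P s → Q s) → count P? ≤ count Q?
  count-mono P? Q? P⇒Q rewrite count≡Σ⊆ P? | count≡Σ⊆ Q? =
    Σ⊆-mono λ s → 𝟙-mono (P? s) (Q? s) P⇒Q

  count-disjoint : ∀ {n} {P Q R : Pred (Subset n) 0ℓ}
    (P? : Decidable P) (Q? : Decidable Q) (R? : Decidable R) →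
    (∀ {s} → P s → R s) → (∀ {s} → Q s → R s) → (∀ {s} → P s → ¬ Q s) →
    count P? + count Q? ≤ count R?
  count-disjoint P? Q? R? P⇒R Q⇒R P⇒¬Q
    rewrite count≡Σ⊆ P? | count≡Σ⊆ Q? | count≡Σ⊆ R? =
    ≤-trans (≤-reflexive (sym (Σ⊆-distrib-+ (𝟙 ∘ P?) (𝟙 ∘ Q?))))
            (Σ⊆-mono λ s → 𝟙-disjoint (P? s) (Q? s) (R? s) P⇒R Q⇒R P⇒¬Q)

  term≤Σ⊆ : ∀ {n} (f : Subset n → ℕ) s → f s ≤ Σ⊆ f
  term≤Σ⊆ f []            = ≤-refl
  term≤Σ⊆ f (inside  ∷ s) = ≤-trans (term≤Σ⊆ (f ∘ (inside ∷_)) s) (m≤m+n _ _)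
  term≤Σ⊆ f (outside ∷ s) = ≤-trans (term≤Σ⊆ (f ∘ (outside ∷_)) s) (m≤n+m _ _)

  count-pos : ∀ {n} {P : Pred (Subset n) 0ℓ} (P? : Decidable P) {s} → P s → 1 ≤ count P?
  count-pos P? {s} Ps rewrite count≡Σ⊆ P? =
    ≤-trans (≤-reflexive (sym (𝟙-yes (P? s) Ps))) (term≤Σ⊆ (𝟙 ∘ P?) s)

  -- Flipping the membership of v is a bijection on all subsets that exchanges those through v with
  -- those avoiding v. It stands in for the deletion of v, so all sets stay over the same vertex
  -- set.
  toggle : ∀ {n} → Fin n → Subset n → Subset n
  toggle v s = s [ v ]%= not

  Σ⊆-toggle : ∀ {n} v (f : Subset n → ℕ) → Σ⊆ f ≡ Σ⊆ (f ∘ toggle v)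
  Σ⊆-toggle zero    f = +-comm (Σ⊆ (f ∘ (inside ∷_))) _
  Σ⊆-toggle (suc v) f =
    cong₂ _+_ (Σ⊆-toggle v (f ∘ (inside ∷_))) (Σ⊆-toggle v (f ∘ (outside ∷_)))

  count-toggle : ∀ {n} v {P : Pred (Subset n) 0ℓ} (P? : Decidable P) →
                 count P? ≡ count (P? ∘ toggle v)
  count-toggle v P? rewrite count≡Σ⊆ P? | count≡Σ⊆ (P? ∘ toggle v) = Σ⊆-toggle v (𝟙 ∘ P?)

  x∉p⇒x∈toggle : ∀ {n} {v : Fin n} {s} → v ∉ s → v ∈ toggle v s
  x∉p⇒x∈toggle {v = zero}  {inside  ∷ s} v∉s = contradiction here v∉s
  x∉p⇒x∈toggle {v = zero}  {outside ∷ s} v∉s = here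
  x∉p⇒x∈toggle {v = suc v} {_ ∷ s}       v∉s = there (x∉p⇒x∈toggle (v∉s ∘ there))

  x∈toggle⇒x∉p : ∀ {n} {v : Fin n} {s} → v ∈ toggle v s → v ∉ s
  x∈toggle⇒x∉p {v = suc v} {_ ∷ s} (there p) (there q) = x∈toggle⇒x∉p p q

  ∣toggle∣ : ∀ {n} {v : Fin n} {s} → v ∉ s → ∣ toggle v s ∣ ≡ suc ∣ s ∣
  ∣toggle∣ {v = zero}  {inside  ∷ s} v∉s = contradiction here v∉s
  ∣toggle∣ {v = zero}  {outside ∷ s} v∉s = refl
  ∣toggle∣ {v = suc v} {inside  ∷ s} v∉s = cong suc (∣toggle∣ (v∉s ∘ there))
  ∣toggle∣ {v = suc v} {outside ∷ s} v∉s = ∣toggle∣ (v∉s ∘ there)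

  p⊆toggle : ∀ {n} {v : Fin n} {s} → v ∉ s → s ⊆ toggle v s
  p⊆toggle {v = zero}  {inside  ∷ s} v∉s = contradiction here v∉s
  p⊆toggle {v = zero}  {outside ∷ s} v∉s = out⊆ ⊆-refl
  p⊆toggle {v = suc v} {_ ∷ s}       v∉s = s⊆s (p⊆toggle (v∉s ∘ there))

  toggle-mono : ∀ {n} {v : Fin n} {s t} → v ∉ t → s ⊆ t → toggle v s ⊆ toggle v t
  toggle-mono {v = zero} {s = b ∷ s} {inside  ∷ t} v∉t s⊆t = contradiction here v∉t
  toggle-mono {v = zero} {s = inside  ∷ s} {outside ∷ t} v∉t s⊆t = contradiction (s⊆t here) λ ()
  toggle-mono {v = zero} {s = outside ∷ s} {outside ∷ t} v∉t s⊆t = in⊆in (drop-∷-⊆ s⊆t)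
  toggle-mono {v = suc v} {s = outside ∷ s} {_ ∷ t} v∉t s⊆t =
    out⊆ (toggle-mono (v∉t ∘ there) (drop-∷-⊆ s⊆t))
  toggle-mono {v = suc v} {s = inside ∷ s} {inside ∷ t} v∉t s⊆t =
    in⊆in (toggle-mono (v∉t ∘ there) (drop-∷-⊆ s⊆t))
  toggle-mono {v = suc v} {s = inside ∷ s} {outside ∷ t} v∉t s⊆t = contradiction (s⊆t here) λ ()

  term≤sum : ∀ {n} (f : Fin n → ℕ) i → f i ≤ sum f
  term≤sum f zero    = m≤m+n _ _
  term≤sum f (suc i) = ≤-trans (term≤sum (f ∘ suc) i) (m≤n+m _ _)

  ∑𝟙-∈ : ∀ {n} (p : Subset n) → sum (λ v → 𝟙 (v ∈? p)) ≡ ∣ p ∣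
  ∑𝟙-∈ []            = refl
  ∑𝟙-∈ (inside  ∷ p) = cong suc (∑𝟙-∈ p)
  ∑𝟙-∈ (outside ∷ p) = ∑𝟙-∈ p

  ∑𝟙-∈× : ∀ {n} (p : Subset n) {A : Set} (d : Dec A) →
          sum (λ v → 𝟙 ((v ∈? p) ×-dec d)) ≡ ∣ p ∣ * 𝟙 d
  ∑𝟙-∈× []            d = refl
  ∑𝟙-∈× (inside  ∷ p) d = cong (𝟙 d +_) (∑𝟙-∈× p d)
  ∑𝟙-∈× (outside ∷ p) d = ∑𝟙-∈× p d

  degree : ∀ {n} {P : Pred (Subset n) 0ℓ} → Decidable P → Fin n → ℕ
  degree P? v = count λ s → (v ∈? s) ×-dec P? s

  -- Double counting of the incident pairs of a vertex and a set: each set that satisfies P contains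
  -- r vertices.
  handshake : ∀ {n} {P : Pred (Subset n) 0ℓ} (P? : Decidable P) r →
              (∀ {s} → P s → ∣ s ∣ ≡ r) → sum (degree P?) ≡ r * count P?
  handshake P? r uniform = begin
    sum (degree P?)
      ≡⟨ sum-cong-≗ (λ v → count≡Σ⊆ (λ s → (v ∈? s) ×-dec P? s)) ⟩
    sum (λ v → Σ⊆ (λ s → 𝟙 ((v ∈? s) ×-dec P? s)))
      ≡⟨ sum-Σ⊆-comm (λ v s → 𝟙 ((v ∈? s) ×-dec P? s)) ⟩
    Σ⊆ (λ s → sum (λ v → 𝟙 ((v ∈? s) ×-dec P? s)))
      ≡⟨ Σ⊆-cong (λ s → trans (∑𝟙-∈× s (P? s)) (size-of s)) ⟩
    Σ⊆ (λ s → r * 𝟙 (P? s))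
      ≡⟨ Σ⊆-distribˡ-* r (𝟙 ∘ P?) ⟩
    r * Σ⊆ (𝟙 ∘ P?)
      ≡⟨ cong (r *_) (sym (count≡Σ⊆ P?)) ⟩
    r * count P? ∎
    where
    open ≡-Reasoning
    size-of : ∀ s → ∣ s ∣ * 𝟙 (P? s) ≡ r * 𝟙 (P? s)
    size-of s with P? s
    ... | yes Ps = cong (_* 1) (uniform Ps)
    ... | no  _  = trans (*-zeroʳ ∣ s ∣) (sym (*-zeroʳ r))

  open Hypergraph

  -- An edge not contained in S has a vertex outside S and is charged to every such vertex.
  edgesNotWithin≤ : ∀ {r} (G : Hypergraph r) (S : Subset (order G)) →
    edgesNotWithin G S ≤ sum (λ v → 𝟙 (¬? (v ∈? S)) * degree (edge? G) v)
  edgesNotWithin≤ G S = begin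
    edgesNotWithin G S
      ≡⟨ count≡Σ⊆ (λ e → edge? G e ×-dec ¬? (e ⊆? S)) ⟩
    Σ⊆ (λ e → 𝟙 (edge? G e ×-dec ¬? (e ⊆? S)))
      ≤⟨ Σ⊆-mono escapes ⟩
    Σ⊆ (λ e → sum (λ v → 𝟙 (¬? (v ∈? S)) * 𝟙 ((v ∈? e) ×-dec edge? G e)))
      ≡⟨ sym (sum-Σ⊆-comm λ v e → 𝟙 (¬? (v ∈? S)) * 𝟙 ((v ∈? e) ×-dec edge? G e)) ⟩
    sum (λ v → Σ⊆ (λ e → 𝟙 (¬? (v ∈? S)) * 𝟙 ((v ∈? e) ×-dec edge? G e)))
      ≡⟨ sum-cong-≗ (λ v → trans
           (Σ⊆-distribˡ-* (𝟙 (¬? (v ∈? S))) (λ e → 𝟙 ((v ∈? e) ×-dec edge? G e)))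
           (cong (𝟙 (¬? (v ∈? S)) *_) (sym (count≡Σ⊆ λ e → (v ∈? e) ×-dec edge? G e)))) ⟩
    sum (λ v → 𝟙 (¬? (v ∈? S)) * degree (edge? G) v) ∎
    where
    open ≤-Reasoning
    escapes : ∀ e → 𝟙 (edge? G e ×-dec ¬? (e ⊆? S)) ≤
              sum (λ v → 𝟙 (¬? (v ∈? S)) * 𝟙 ((v ∈? e) ×-dec edge? G e))
    escapes e = 𝟙≤ (edge? G e ×-dec ¬? (e ⊆? S)) λ (Ee , e⊈S) → through Ee e⊈S
      where
      through : Edge G e → ¬ (e ⊆ S) →
                1 ≤ sum (λ v → 𝟙 (¬? (v ∈? S)) * 𝟙 ((v ∈? e) ×-dec edge? G e))
      through Ee e⊈S with Fin.any? (λ v → (v ∈? e) ×-dec ¬? (v ∈? S))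
      ... | no ¬out = contradiction
              (λ {v} v∈e → decidable-stable (v ∈? S) λ v∉S → ¬out (v , v∈e , v∉S)) e⊈S
      ... | yes (v , v∈e , v∉S) = ≤-trans
              (≤-reflexive (sym (cong₂ _*_ (𝟙-yes (¬? (v ∈? S)) v∉S)
                                           (𝟙-yes ((v ∈? e) ×-dec edge? G e) (v∈e , Ee)))))
              (term≤sum (λ v → 𝟙 (¬? (v ∈? S)) * 𝟙 ((v ∈? e) ×-dec edge? G e)) v)

  -- The vertex v remains in its own link as an isolated vertex, which avoids renumbering the
  -- others.
  link : ∀ {k} (G : Hypergraph (suc k)) → Fin (order G) → Hypergraph k
  link G v = record
    { order   = order G
    ; Edge    = λ e → v ∉ e × Edge G (toggle v e)
    ; edge?   = λ e → ¬? (v ∈? e) ×-dec edge? G (toggle v e)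
    ; uniform = λ (v∉e , Ee) → suc-injective (trans (sym (∣toggle∣ v∉e)) (uniform G Ee))
    }

  size-link : ∀ {k} (G : Hypergraph (suc k)) v → size (link G v) ≡ degree (edge? G) v
  size-link G v = trans
    (≤-antisym
      (count-mono (edge? (link G v)) (λ s → (v ∈? toggle v s) ×-dec edge? G (toggle v s))
        λ (v∉e , Ee) → x∉p⇒x∈toggle v∉e , Ee)
      (count-mono (λ s → (v ∈? toggle v s) ×-dec edge? G (toggle v s)) (edge? (link G v))
        λ (v∈te , Ee) → x∈toggle⇒x∉p v∈te , Ee))
    (sym (count-toggle v (λ s → (v ∈? s) ×-dec edge? G s)))

  -- Deleting v turns a clique through v into a clique of the link. Equality may fail, since a
  -- clique of the link need not be an edge of G.
  cliqueDegree≤link : ∀ {k} (G : Hypergraph (suc k)) v →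
                      degree (isClique? G) v ≤ cliqueCount (link G v)
  cliqueDegree≤link G v = ≤-trans
    (≤-reflexive (count-toggle v (λ s → (v ∈? s) ×-dec isClique? G s)))
    (count-mono (λ s → (v ∈? toggle v s) ×-dec isClique? G (toggle v s)) (isClique? (link G v))
      λ {s} (v∈ts , ∣ts∣ , full) → let v∉s = x∈toggle⇒x∉p {s = s} v∈ts in
        suc-injective (trans (sym (∣toggle∣ v∉s)) ∣ts∣) ,
        λ e⊆s ∣e∣ → let v∉e = λ v∈e → v∉s (e⊆s v∈e) in
          v∉e , full (toggle-mono v∉s e⊆s) (trans (∣toggle∣ v∉e) (cong suc ∣e∣)))

  -- Deleting v from a clique through v leaves an edge that avoids v.
  cliqueDegree+degree≤size : ∀ {k} (G : Hypergraph (suc k)) v →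
    degree (isClique? G) v + degree (edge? G) v ≤ size G
  cliqueDegree+degree≤size G v = ≤-trans
    (≤-reflexive (cong (_+ degree (edge? G) v)
      (count-toggle v (λ s → (v ∈? s) ×-dec isClique? G s))))
    (count-disjoint (λ s → (v ∈? toggle v s) ×-dec isClique? G (toggle v s))
      (λ s → (v ∈? s) ×-dec edge? G s) (edge? G)
      (λ {s} (v∈ts , ∣ts∣ , full) → let v∉s = x∈toggle⇒x∉p {s = s} v∈ts in
        full (p⊆toggle v∉s) (suc-injective (trans (sym (∣toggle∣ v∉s)) ∣ts∣)))
      proj₂
      (λ {s} (v∈ts , _) (v∈s , _) → x∈toggle⇒x∉p {s = s} v∈ts v∈s))

  -- S is nested with L: it lies inside L or contains it.
  nestedSubset : ∀ {n} (L : Subset n) {m} → m ≤ n →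
                 ∃[ S ] ∣ S ∣ ≡ m × ∣ L ─ S ∣ ≡ ∣ L ∣ ∸ m
  nestedSubset {n} L {zero} _ = ⊥ , ∣⊥∣≡0 n , cong ∣_∣ (p─⊥≡p L)
  nestedSubset (inside ∷ L) {suc m} (s≤s m≤n) =
    let S , ∣S∣ , eq = nestedSubset L m≤n in inside ∷ S , cong suc ∣S∣ , eq
  -- A position outside `L` is skipped while the remaining ones can still hold `suc m` elements.
  -- Once they cannot, `suc m` is the number of all positions, and the full set contains `L`.
  nestedSubset {suc n} (outside ∷ L) {suc m} m≤n with suc m ≤? n
  ... | yes m<n = let S , ∣S∣ , eq = nestedSubset L m<n in outside ∷ S , ∣S∣ , eq
  ... | no  m≮n = ⊤ , trans (∣⊤∣≡n (suc n)) (≤-antisym (≰⇒> m≮n) m≤n) , (begin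
    ∣ L ─ ⊤ ∣      ≡⟨ cong ∣_∣ (p─⊤≡⊥ L) ⟩
    ∣ ⊥ {n} ∣      ≡⟨ ∣⊥∣≡0 n ⟩
    0              ≡⟨ sym (m≤n⇒m∸n≡0 (≤-trans (∣p∣≤n L) (<⇒≤ (≰⇒> m≮n)))) ⟩
    ∣ L ∣ ∸ suc m  ∎)
    where open ≡-Reasoning

-- Rational arithmetic and falling factorials

module Rationals where

  import Data.Integer.Base as ℤ
  import Data.Integer.Properties as ℤ
  open import Data.Nat.Base as ℕ using (ℕ; zero; suc; _!)
  import Data.Nat.Properties as ℕ
  open import Data.Fin.Base using (Fin; zero; suc)
  open import Data.Rational.Base
  open import Data.Rational.Properties
  open import Data.Rational.Solver using (module +-*-Solver)
  import Data.Rational.Unnormalised.Base as ℚᵘ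
  import Data.Rational.Unnormalised.Properties as ℚᵘ
  open import Function.Base using (_∘_)
  open import Data.Sum.Base using (inj₁; inj₂)
  open import Relation.Binary.PropositionalEquality
  open import Relation.Nullary
  open +-*-Solver
  open Counting using (sum)

  infixl 6 _⊕_
  infixl 7 _⊗_

  _⊕_ : ∀ {p q} → 0ℚ ≤ p → 0ℚ ≤ q → 0ℚ ≤ p + q
  _⊕_ = +-mono-≤

  _⊗_ : ∀ {p q} → 0ℚ ≤ p → 0ℚ ≤ q → 0ℚ ≤ p * q
  _⊗_ {p} {q} 0≤p 0≤q =
    nonNegative⁻¹ (p * q) ⦃ nonNeg*nonNeg⇒nonNeg p ⦃ nonNegative 0≤p ⦄ q ⦃ nonNegative 0≤q ⦄ ⦄

  0<* : ∀ {p q} → 0ℚ < p → 0ℚ < q → 0ℚ < p * q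
  0<* {p} {q} 0<p 0<q =
    positive⁻¹ (p * q) ⦃ pos*pos⇒pos p ⦃ positive 0<p ⦄ q ⦃ positive 0<q ⦄ ⦄

  0<⊕ : ∀ {p q} → 0ℚ < p → 0ℚ ≤ q → 0ℚ < p + q
  0<⊕ = +-mono-<-≤

  0<⊓ : ∀ {p q} → 0ℚ < p → 0ℚ < q → 0ℚ < p ⊓ q
  0<⊓ {p} {q} 0<p 0<q with ⊓-sel p q
  ... | inj₁ eq = subst (0ℚ <_) (sym eq) 0<p
  ... | inj₂ eq = subst (0ℚ <_) (sym eq) 0<q

  p≤q⇒0≤q-p : ∀ {p q} → p ≤ q → 0ℚ ≤ q - p
  p≤q⇒0≤q-p {p} {q} p≤q = subst (_≤ q - p) (+-inverseʳ p) (+-monoˡ-≤ (- p) p≤q)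

  p<q⇒0<q-p : ∀ {p q} → p < q → 0ℚ < q - p
  p<q⇒0<q-p {p} {q} p<q = subst (_< q - p) (+-inverseʳ p) (+-monoˡ-< (- p) p<q)

  private
    recover : ∀ p q → (q - p) + p ≡ q
    recover = solve 2 (λ p q → (q :- p) :+ p := q) refl

  -- A polynomial inequality is certified by writing q - p as a sum of products of
  -- terms known to be nonnegative.
  ≤-by : ∀ {p q c} → 0ℚ ≤ c → q - p ≡ c → p ≤ q
  ≤-by {p} {q} 0≤c eq = subst₂ _≤_ (+-identityˡ p) (recover p q)
    (+-monoˡ-≤ p (subst (0ℚ ≤_) (sym eq) 0≤c))

  <-by : ∀ {p q c} → 0ℚ < c → q - p ≡ c → p < q
  <-by {p} {q} 0<c eq = subst₂ _<_ (+-identityˡ p) (recover p q)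
    (+-monoˡ-< p (subst (0ℚ <_) (sym eq) 0<c))

  *-cancel-0≤ : ∀ {p q} → 0ℚ < p → 0ℚ ≤ p * q → 0ℚ ≤ q
  *-cancel-0≤ {p} {q} 0<p 0≤pq =
    *-cancelˡ-≤-pos p ⦃ positive 0<p ⦄ (subst (_≤ p * q) (sym (*-zeroʳ p)) 0≤pq)

  opaque
    -- Opaque, so that later computations treat casts as atoms and never unfold the normalisation of
    -- fractions.
    toℚ : ℕ → ℚ
    toℚ n = ℤ.+ n / 1

    toℚ-def : ∀ n → toℚ n ≡ ℤ.+ n / 1
    toℚ-def n = refl

    toℚ-0 : toℚ 0 ≡ 0ℚ
    toℚ-0 = refl

    toℚ-1 : toℚ 1 ≡ 1ℚ
    toℚ-1 = refl

  private
    toℚᵘ-toℚ : ∀ n → toℚᵘ (toℚ n) ℚᵘ.≃ ℚᵘ.mkℚᵘ (ℤ.+ n) 0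
    toℚᵘ-toℚ n rewrite toℚ-def n = toℚᵘ-fromℚᵘ (ℚᵘ.mkℚᵘ (ℤ.+ n) 0)

  toℚ-+ : ∀ m n → toℚ (m ℕ.+ n) ≡ toℚ m + toℚ n
  toℚ-+ m n = toℚᵘ-injective (ℚᵘ.≃-trans (toℚᵘ-toℚ (m ℕ.+ n)) (ℚᵘ.≃-sym
    (ℚᵘ.≃-trans (toℚᵘ-homo-+ (toℚ m) (toℚ n))
    (ℚᵘ.≃-trans (ℚᵘ.+-cong (toℚᵘ-toℚ m) (toℚᵘ-toℚ n))
      (ℚᵘ.*≡* (cong (ℤ._* ℤ.+ 1) (cong₂ ℤ._+_ (ℤ.*-identityʳ (ℤ.+ m)) (ℤ.*-identityʳ (ℤ.+ n)))))))))

  toℚ-* : ∀ m n → toℚ (m ℕ.* n) ≡ toℚ m * toℚ n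
  toℚ-* m n = toℚᵘ-injective (ℚᵘ.≃-trans (toℚᵘ-toℚ (m ℕ.* n)) (ℚᵘ.≃-sym
    (ℚᵘ.≃-trans (toℚᵘ-homo-* (toℚ m) (toℚ n))
    (ℚᵘ.≃-trans (ℚᵘ.*-cong (toℚᵘ-toℚ m) (toℚᵘ-toℚ n))
      (ℚᵘ.*≡* (cong (ℤ._* ℤ.+ 1) (sym (ℤ.pos-* m n))))))))

  toℚ-suc : ∀ n → toℚ (suc n) ≡ toℚ n + 1ℚ
  toℚ-suc n = trans (cong toℚ (sym (ℕ.+-comm n 1))) (trans (toℚ-+ n 1) (cong (toℚ n +_) toℚ-1))

  0≤toℚ : ∀ n → 0ℚ ≤ toℚ n
  0≤toℚ zero    = ≤-reflexive (sym toℚ-0)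
  0≤toℚ (suc n) = subst (0ℚ ≤_) (sym (toℚ-suc n)) (0≤toℚ n ⊕ nonNegative⁻¹ 1ℚ)

  toℚ-mono-≤ : ∀ {m n} → m ℕ.≤ n → toℚ m ≤ toℚ n
  toℚ-mono-≤ {m} {n} m≤n = subst₂ _≤_ (+-identityʳ (toℚ m))
    (trans (sym (toℚ-+ m (n ℕ.∸ m))) (cong toℚ (ℕ.m+[n∸m]≡n m≤n)))
    (+-monoʳ-≤ (toℚ m) (0≤toℚ (n ℕ.∸ m)))

  toℚ-cancel-< : ∀ {m n} → toℚ m < toℚ n → m ℕ.< n
  toℚ-cancel-< m<n = ℕ.≰⇒> λ n≤m → <-irrefl refl (<-≤-trans m<n (toℚ-mono-≤ n≤m))

  toℚ-suc-∸ : ∀ n → toℚ (suc n) - 1ℚ ≡ toℚ n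
  toℚ-suc-∸ n rewrite toℚ-suc n = solve 1 (λ n → n :+ con 1ℚ :- con 1ℚ := n) refl (toℚ n)

  0≤1 : 0ℚ ≤ 1ℚ
  0≤1 = nonNegative⁻¹ 1ℚ

  0<toℚ-suc : ∀ n → 0ℚ < toℚ (suc n)
  0<toℚ-suc n = <-≤-trans (subst (0ℚ <_) (sym toℚ-1) (positive⁻¹ 1ℚ)) (toℚ-mono-≤ (ℕ.s≤s ℕ.z≤n))

  0<toℚ-! : ∀ n → 0ℚ < toℚ (n !)
  0<toℚ-! n = <-≤-trans (0<toℚ-suc 0) (toℚ-mono-≤ (ℕ.1≤n! n))

  toℚ-! : ∀ k → toℚ (suc k !) ≡ toℚ (suc k) * toℚ (k !)
  toℚ-! k = toℚ-* (suc k) (k !)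

  sum-linear : ∀ {n} (f g h i : Fin n → ℕ) p q r s →
    (∀ v → p * toℚ (f v) + q * toℚ (g v) ≤ r * toℚ (h v) + s * toℚ (i v)) →
    p * toℚ (sum f) + q * toℚ (sum g) ≤ r * toℚ (sum h) + s * toℚ (sum i)
  sum-linear {zero} f g h i p q r s H rewrite toℚ-0 = ≤-reflexive
    (solve 4 (λ p q r s → p :* con 0ℚ :+ q :* con 0ℚ := r :* con 0ℚ :+ s :* con 0ℚ) refl p q r s)
  sum-linear {suc n} f g h i p q r s H = subst₂ _≤_ (sym (split f g p q)) (sym (split h i r s))
    (+-mono-≤ (H zero) (sum-linear (f ∘ suc) (g ∘ suc) (h ∘ suc) (i ∘ suc) p q r s (H ∘ suc)))
    where
    split : ∀ (f g : Fin (suc n) → ℕ) p q → p * toℚ (sum f) + q * toℚ (sum g) ≡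
      (p * toℚ (f zero) + q * toℚ (g zero)) + (p * toℚ (sum (f ∘ suc)) + q * toℚ (sum (g ∘ suc)))
    split f g p q rewrite toℚ-+ (f zero) (sum (f ∘ suc)) | toℚ-+ (g zero) (sum (g ∘ suc)) =
      solve 6 (λ p q a b c d → p :* (a :+ b) :+ q :* (c :+ d)
                := (p :* a :+ q :* c) :+ (p :* b :+ q :* d)) refl
        p q (toℚ (f zero)) (toℚ (sum (f ∘ suc))) (toℚ (g zero)) (toℚ (sum (g ∘ suc)))

  sum-scaled : ∀ {n} (f g : Fin n → ℕ) p q →
    (∀ v → p * toℚ (f v) ≤ q * toℚ (g v)) → p * toℚ (sum f) ≤ q * toℚ (sum g)
  sum-scaled f g p q H = subst₂ _≤_ (drop p (sum f)) (drop q (sum g))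
    (sum-linear f f g g p 0ℚ q 0ℚ λ v →
      subst₂ _≤_ (sym (drop p (f v))) (sym (drop q (g v))) (H v))
    where
    drop : ∀ p n → p * toℚ n + 0ℚ * toℚ n ≡ p * toℚ n
    drop p n = solve 2 (λ p n → p :* n :+ con 0ℚ :* n := p :* n) refl p (toℚ n)

  -- The falling factorial q(q-1)...(q-k+1), which is k! C(q,k); bounds on binomial coefficients are
  -- stated with it to stay free of denominators.
  ff : ℚ → ℕ → ℚ
  ff q zero    = 1ℚ
  ff q (suc k) = ff q k * (q - toℚ k)

  -- Splits off the first factor instead of the last. Scaled, this is r C(y,r) = y C(y-1,r-1), the
  -- link between |G| and the degree threshold.
  ff-shift : ∀ y k → ff y (suc k) ≡ y * ff (y - 1ℚ) k
  ff-shift y zero rewrite toℚ-0 = solve 1 (λ y → con 1ℚ :* (y :- con 0ℚ) := y :* con 1ℚ) refl y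
  ff-shift y (suc k) rewrite ff-shift y k | toℚ-suc k =
    solve 3 (λ y b k → y :* b :* (y :- (k :+ con 1ℚ)) := y :* (b :* (y :- con 1ℚ :- k))) refl
      y (ff (y - 1ℚ) k) (toℚ k)

  suc≤⇒≤ : ∀ k {u} → toℚ (suc k) ≤ u → toℚ k ≤ u
  suc≤⇒≤ k = ≤-trans (toℚ-mono-≤ (ℕ.n≤1+n k))

  suc≤+1⇒≤ : ∀ k {u} → toℚ (suc k) ≤ u + 1ℚ → toℚ k ≤ u
  suc≤+1⇒≤ k {u} h = ≤-by (p≤q⇒0≤q-p (subst (_≤ u + 1ℚ) (toℚ-suc k) h))
    (solve 2 (λ u k → u :- k := (u :+ con 1ℚ) :- (k :+ con 1ℚ)) refl u (toℚ k))

  -- The smallest factor is u - (k - 1), so u may lie up to 1 below k.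
  ff-nonNeg : ∀ {u} k → toℚ k ≤ u + 1ℚ → 0ℚ ≤ ff u k
  ff-nonNeg zero h = 0≤1
  ff-nonNeg {u} (suc k) h = ff-nonNeg k (suc≤⇒≤ k h) ⊗ p≤q⇒0≤q-p (suc≤+1⇒≤ k {u} h)

  ff-≥1 : ∀ {u} k → toℚ k ≤ u → 1ℚ ≤ ff u k
  ff-≥1 zero h = ≤-refl
  ff-≥1 {u} (suc k) h = ≤-by
    (p≤q⇒0≤q-p (ff-≥1 k (suc≤⇒≤ k h)) ⊗ p≤q⇒0≤q-p (suc≤⇒≤ k h)
      ⊕ p≤q⇒0≤q-p (subst (_≤ u) (toℚ-suc k) h))
    (solve 3 (λ f u k → f :* (u :- k) :- con 1ℚ
               := (f :- con 1ℚ) :* (u :- k) :+ (u :- (k :+ con 1ℚ))) refl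
      (ff u k) u (toℚ k))

  private
    difference : ∀ f g u w k → g * (w - k) - f * (u - k) ≡ (g - f) * (u - k) + g * (w - u)
    difference = solve 5 (λ f g u w k → g :* (w :- k) :- f :* (u :- k)
      := (g :- f) :* (u :- k) :+ g :* (w :- u)) refl

  -- Product rule: the difference splits into a term for the change of the earlier factors and one
  -- for the change of the last factor, both nonnegative.
  ff-mono : ∀ {u w} k → toℚ k ≤ u + 1ℚ → u ≤ w → ff u k ≤ ff w k
  ff-mono zero h u≤w = ≤-refl
  ff-mono {u} {w} (suc k) h u≤w = ≤-by
    (p≤q⇒0≤q-p (ff-mono k (suc≤⇒≤ k h) u≤w) ⊗ p≤q⇒0≤q-p (suc≤+1⇒≤ k {u} h)
      ⊕ ff-nonNeg k (≤-trans (suc≤⇒≤ k h) (+-monoˡ-≤ 1ℚ u≤w)) ⊗ p≤q⇒0≤q-p u≤w)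
    (difference (ff u k) (ff w k) u w (toℚ k))

  p≤p+1 : ∀ {k u} → k ≤ u → k ≤ u + 1ℚ
  p≤p+1 {k} {u} k≤u = ≤-by (p≤q⇒0≤q-p k≤u ⊕ 0≤1)
    (solve 2 (λ k u → u :+ con 1ℚ :- k := u :- k :+ con 1ℚ) refl k u)

  -- The last factor grows by w - u and is multiplied by `ff w k`, which is at least 1. So an error
  -- in the value bounds the error in the argument.
  ff-growth : ∀ {u w} k → toℚ k ≤ u → u ≤ w → ff u (suc k) + (w - u) ≤ ff w (suc k)
  ff-growth {u} {w} k k≤u u≤w = ≤-by
    (p≤q⇒0≤q-p (ff-mono k (p≤p+1 k≤u) u≤w) ⊗ p≤q⇒0≤q-p k≤u
      ⊕ p≤q⇒0≤q-p (ff-≥1 {w} k (≤-trans k≤u u≤w)) ⊗ p≤q⇒0≤q-p u≤w)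
    (solve 5 (λ f g u w k → g :* (w :- k) :- (f :* (u :- k) :+ (w :- u))
      := (g :- f) :* (u :- k) :+ (g :- con 1ℚ) :* (w :- u)) refl
      (ff u k) (ff w k) u w (toℚ k))

  -- As w - u is at most s times the smallest factor w + 1 - k, each factor shrinks by at most the
  -- ratio 1 - s; Bernoulli's inequality turns (1-s)^k into 1 - ks.
  ff-ratio : ∀ {s u w} k → 0ℚ ≤ s → s ≤ 1ℚ → toℚ k ≤ w + 1ℚ →
    w - u ≤ s * (w + 1ℚ - toℚ k) → (1ℚ - toℚ k * s) * ff w k ≤ ff u k
  ff-ratio {s} zero 0≤s s≤1 k≤w near rewrite toℚ-0 =
    ≤-reflexive (solve 1 (λ s → (con 1ℚ :- con 0ℚ :* s) :* con 1ℚ := con 1ℚ) refl s)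
  ff-ratio {s} {u} {w} (suc k) 0≤s s≤1 k≤w near = ≤-by
    -- The last summand is the Bernoulli slack: (1-ks)(1-s) exceeds 1-(k+1)s by ks².
    (fu ⊗ 0≤gap ⊕ p≤q⇒0≤q-p rec ⊗ (p≤q⇒0≤q-p s≤1 ⊗ w-k) ⊕ fw ⊗ w-k ⊗ (0≤toℚ k ⊗ (0≤s ⊗ 0≤s)))
    (trans
      (cong (λ j → ff u k * (u - toℚ k) - (1ℚ - j * s) * (ff w k * (w - toℚ k))) (toℚ-suc k))
      (solve 6 (λ f g s u w k →
         f :* (u :- k) :- (con 1ℚ :- (k :+ con 1ℚ) :* s) :* (g :* (w :- k))
         := f :* (s :* (w :- k) :- (w :- u))
            :+ (f :- (con 1ℚ :- k :* s) :* g) :* ((con 1ℚ :- s) :* (w :- k))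
            :+ g :* (w :- k) :* (k :* (s :* s))) refl
        (ff u k) (ff w k) s u w (toℚ k)))
    where
    k≤w′ : toℚ k ≤ w
    k≤w′ = suc≤+1⇒≤ k k≤w
    w-k = p≤q⇒0≤q-p k≤w′
    fw = ff-nonNeg k (suc≤⇒≤ k k≤w)
    near′ : w - u ≤ s * (w - toℚ k)
    near′ = subst (λ j → w - u ≤ s * j)
      (trans (cong (λ j → w + 1ℚ - j) (toℚ-suc k))
        (solve 2 (λ w k → w :+ con 1ℚ :- (k :+ con 1ℚ) := w :- k) refl w (toℚ k))) near
    0≤gap = p≤q⇒0≤q-p near′
    k≤u : toℚ k ≤ u
    k≤u = ≤-by (p≤q⇒0≤q-p s≤1 ⊗ w-k ⊕ 0≤gap)
      (solve 4 (λ s u w k → u :- k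
         := (con 1ℚ :- s) :* (w :- k) :+ (s :* (w :- k) :- (w :- u))) refl s u w (toℚ k))
    fu = ff-nonNeg k (p≤p+1 k≤u)
    rec = ff-ratio {s} {u} {w} k 0≤s s≤1 (suc≤⇒≤ k k≤w)
      (≤-by (0≤gap ⊕ 0≤s) (solve 4 (λ s u w k →
         s :* (w :+ con 1ℚ :- k) :- (w :- u) := s :* (w :- k) :- (w :- u) :+ s) refl
         s u w (toℚ k)))

-- The clique bound of Kruskal-Katona type

module KruskalKatona where

  open import Data.Fin.Base using (Fin)
  open import Data.Fin.Subset using (⊥)
  open import Data.Fin.Subset.Properties using (⊥⊆; ∣⊥∣≡0)
  open import Data.Nat.Base as ℕ using (ℕ; zero; suc; _!)
  import Data.Nat.Properties as ℕ
  open import Data.Product.Base using (_,_)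
  open import Data.Rational.Base
  open import Data.Rational.Properties
  open import Data.Rational.Solver using (module +-*-Solver)
  open import Relation.Binary.PropositionalEquality
  open import Relation.Nullary
  open +-*-Solver
  open Hypergraph
  open Counting
  open Rationals

  pred-≤ : ∀ k {y} → toℚ (suc k) ≤ y → toℚ k ≤ y - 1ℚ
  pred-≤ k {y} h = ≤-by (p≤q⇒0≤q-p (subst (_≤ y) (toℚ-suc k) h))
    (solve 2 (λ y k → y :- con 1ℚ :- k := y :- (k :+ con 1ℚ)) refl y (toℚ k))

  mutual
    cliqueDegree-bound : ∀ k (G : Hypergraph (suc k)) y → toℚ (suc k) ≤ y →
      toℚ (suc k !) * toℚ (size G) ≤ ff y (suc k) → ∀ v →
      toℚ (suc k) * toℚ (degree (isClique? G) v) ≤ (y - toℚ (suc k)) * toℚ (degree (edge? G) v)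
    cliqueDegree-bound k G y k<y sized v with toℚ (k !) * toℚ (degree (edge? G) v) <? ff (y - 1ℚ) k
    -- The link is treated with y - 1, and (y - 1) - k = y - (k + 1) is the factor wanted here.
    ... | yes low = ≤-trans
      (*-monoˡ-≤-nonNeg (toℚ (suc k)) ⦃ nonNegative (0≤toℚ (suc k)) ⦄
        (toℚ-mono-≤ (cliqueDegree≤link G v)))
      (subst₂ (λ d c → toℚ (suc k) * toℚ (cliqueCount (link G v)) ≤ c * toℚ d)
        (size-link G v)
        (trans (solve 2 (λ y k → y :- con 1ℚ :- k := y :- (k :+ con 1ℚ)) refl y (toℚ k))
               (cong (λ j → y - j) (sym (toℚ-suc k))))
        (clique-bound k (link G v) (y - 1ℚ) (pred-≤ k k<y)
          (subst (λ d → toℚ (k !) * toℚ d < ff (y - 1ℚ) k) (sym (size-link G v)) low)))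
    -- With r = k + 1, the slacks of k! d ≥ B, of r! m ≤ yB and of c + d ≤ m, weighted by y, 1 and
    -- k! r, add up to k! times the deficit of v.
    ... | no high = ≤-by
      (*-cancel-0≤ (0<toℚ-! k) (subst (0ℚ ≤_)
        (solve 7 (λ a y d b m c k →
             y :* (a :* d :- b) :+ (y :* b :- k :* a :* m) :+ a :* k :* (m :- (c :+ d))
             := a :* ((y :- k) :* d :- k :* c)) refl a y d B m c (toℚ (suc k)))
        (0≤y ⊗ p≤q⇒0≤q-p (≮⇒≥ high)
          ⊕ p≤q⇒0≤q-p (subst₂ (λ p q → p * m ≤ q) (toℚ-! k) (ff-shift y k) sized)
          ⊕ 0≤toℚ (k !) ⊗ 0≤toℚ (suc k) ⊗ p≤q⇒0≤q-p
              (subst (_≤ m) (toℚ-+ (degree (isClique? G) v) (degree (edge? G) v))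
                (toℚ-mono-≤ (cliqueDegree+degree≤size G v))))))
      refl
      where
      a = toℚ (k !)
      B = ff (y - 1ℚ) k
      d = toℚ (degree (edge? G) v)
      c = toℚ (degree (isClique? G) v)
      m = toℚ (size G)
      0≤y = ≤-trans (0≤toℚ (suc k)) k<y

    -- Lovász's form of the bound: if |G| = C(y,r), the right side is (r+1) C(y,r+1). Summing the
    -- vertex bounds and double counting gives both sides with a common factor r, which cancels.
    cliqueCount-bound : ∀ k (G : Hypergraph (suc k)) y → toℚ (suc k) ≤ y →
      toℚ (suc k !) * toℚ (size G) ≤ ff y (suc k) →
      toℚ (suc (suc k)) * toℚ (cliqueCount G) ≤ (y - toℚ (suc k)) * toℚ (size G)
    cliqueCount-bound k G y k<y sized = ≤-by
      (*-cancel-0≤ (0<toℚ-suc k) (subst (0ℚ ≤_)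
        (trans (cong₂ (λ p q → (y - toℚ (suc k)) * p - toℚ (suc k) * q)
             (trans (cong toℚ (handshake (edge? G) (suc k) (uniform G))) (toℚ-* (suc k) (size G)))
             (trans (cong toℚ (handshake (isClique? G) (suc (suc k)) λ (∣T∣ , _) → ∣T∣))
                    (toℚ-* (suc (suc k)) (cliqueCount G))))
           (solve 5 (λ y k m l c → (y :- k) :* (k :* m) :- k :* (l :* c)
                      := k :* ((y :- k) :* m :- l :* c)) refl
             y (toℚ (suc k)) (toℚ (size G)) (toℚ (suc (suc k))) (toℚ (cliqueCount G))))
        (p≤q⇒0≤q-p (sum-scaled (degree (isClique? G)) (degree (edge? G))
          (toℚ (suc k)) (y - toℚ (suc k)) (cliqueDegree-bound k G y k<y sized)))))
      refl

    -- With the strict hypothesis the bound also holds for k = 0, where G has no edge.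
    clique-bound : ∀ k (G : Hypergraph k) y → toℚ k ≤ y →
      toℚ (k !) * toℚ (size G) < ff y k →
      toℚ (suc k) * toℚ (cliqueCount G) ≤ (y - toℚ k) * toℚ (size G)
    clique-bound (suc k) G y k<y sized = cliqueCount-bound k G y k<y (<⇒≤ sized)
    clique-bound zero G y 0≤y sized = subst₂ _≤_
      (sym (trans (cong (λ c → toℚ 1 * c) (trans (cong toℚ cliques≡0) toℚ-0)) (*-zeroʳ (toℚ 1))))
      (sym (trans (cong (λ m → (y - toℚ 0) * m) (trans (cong toℚ size≡0) toℚ-0)) (*-zeroʳ (y - toℚ 0))))
      ≤-refl
      where
      size≡0 : size G ≡ 0
      size≡0 = ℕ.n<1⇒n≡0 (toℚ-cancel-< (subst₂ _<_
        (trans (cong (_* toℚ (size G)) toℚ-1) (*-identityˡ (toℚ (size G)))) (sym toℚ-1) sized))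
      cliques≡0 : cliqueCount G ≡ 0
      -- For k = 0 a clique contains the empty set, which would then be an edge.
      cliques≡0 = ℕ.n≤0⇒n≡0 (subst (cliqueCount G ℕ.≤_) size≡0
        (count-mono (isClique? G) (edge? G) λ (_ , full) →
          contradiction (subst (1 ℕ.≤_) size≡0
            (count-pos (edge? G) (full ⊥⊆ (∣⊥∣≡0 (order G))))) λ ()))

-- Stability for a rational upper approximation of x

module Stability where

  open import Data.Fin.Base using (Fin; zero; suc)
  open import Data.Fin.Subset using (Subset; _∈_; ∣_∣; _─_)
  open import Data.Fin.Subset.Properties using (_∈?_; x∈p∧x∉q⇒x∈p─q)
  open import Data.Nat.Base as ℕ using (ℕ; zero; suc; _!)
  import Data.Nat.Properties as ℕ
  open import Data.Product.Base using (∃-syntax; _×_; _,_; proj₁; proj₂)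
  open import Data.Rational.Base hiding (∣_∣)
  open import Data.Rational.Properties
  open import Data.Rational.Solver using (module +-*-Solver)
  open import Data.Vec.Base using (_∷_; []; here; there)
  open import Function.Base using (_∘_)
  open import Relation.Binary.PropositionalEquality
  open import Relation.Nullary
  open import Relation.Unary using (Pred; Decidable)
  open import Level using (0ℓ)
  open +-*-Solver
  open Hypergraph
  open Counting
  open Rationals
  open KruskalKatona

  comprehension : ∀ {n} {P : Pred (Fin n) 0ℓ} → Decidable P → Subset n
  comprehension {zero}  P? = []
  comprehension {suc n} P? = does (P? zero) ∷ comprehension (P? ∘ suc)

  ∈-comprehension⁻ : ∀ {n} {P : Pred (Fin n) 0ℓ} (P? : Decidable P) {v} →
                     v ∈ comprehension P? → P v
  ∈-comprehension⁻ P? {zero} v∈ with P? zero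
  ... | yes p = p
  ∈-comprehension⁻ P? {zero} () | no _
  ∈-comprehension⁻ P? {suc v} (there v∈) = ∈-comprehension⁻ (P? ∘ suc) v∈

  ∈-comprehension⁺ : ∀ {n} {P : Pred (Fin n) 0ℓ} (P? : Decidable P) {v} →
                     P v → v ∈ comprehension P?
  ∈-comprehension⁺ P? {zero} p with P? zero
  ... | yes _ = here
  ... | no ¬p = contradiction p ¬p
  ∈-comprehension⁺ P? {suc v} p = there (∈-comprehension⁺ (P? ∘ suc) p)

  -- `κ` stands for the ceiling of x, η is the relative distance from y down to z, and δ is the
  -- relative loss of cliques. θ = r(r+1)η bounds both the relative drop between the degree
  -- thresholds and the excess of y over `κ`.
  module Core {k} (G : Hypergraph (suc k)) (y η δ : ℚ) (κ : ℕ)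
    (K2≤y : toℚ (suc (suc k)) ≤ y)
    (sized : toℚ (suc k !) * toℚ (size G) ≤ ff y (suc k))
    (0<η : 0ℚ < η)
    (K2η≤1 : toℚ (suc (suc k)) * η ≤ 1ℚ)
    (0≤δ : 0ℚ ≤ δ)
    (many : (1ℚ - δ) * (y - toℚ (suc k)) * toℚ (size G) ≤ toℚ (suc (suc k)) * toℚ (cliqueCount G))
    (θ≤½ : toℚ 2 * (toℚ (suc k) * toℚ (suc (suc k)) * η) ≤ 1ℚ)
    (y≤κ+θ : y ≤ toℚ κ + toℚ (suc k) * toℚ (suc (suc k)) * η)
    (κ≤n : κ ℕ.≤ order G)
    where

    -- B and c are the thresholds C(y-1,k) and C(z-1,k) for the degree, scaled by a = k!.
    a K1 K2 θ z B c m : ℚ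
    a  = toℚ (k !)
    K1 = toℚ (suc k)
    K2 = toℚ (suc (suc k))
    θ  = K1 * K2 * η
    z  = y - η * y
    B  = ff (y - 1ℚ) k
    c  = ff (z - 1ℚ) k
    m  = toℚ (size G)

    deg cdeg : Fin (order G) → ℕ
    deg  = degree (edge? G)
    cdeg = degree (isClique? G)

    K2≡ : K2 ≡ K1 + 1ℚ
    K2≡ = toℚ-suc (suc k)

    0≤a : 0ℚ ≤ a
    0≤a = 0≤toℚ (k !)

    0≤η : 0ℚ ≤ η
    0≤η = <⇒≤ 0<η

    0≤θ : 0ℚ ≤ θ
    0≤θ = 0≤toℚ (suc k) ⊗ 0≤toℚ (suc (suc k)) ⊗ 0≤η

    K1≤y : K1 ≤ y
    K1≤y = suc≤⇒≤ (suc k) K2≤y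

    0<y : 0ℚ < y
    0<y = <-≤-trans (0<toℚ-suc k) K1≤y

    0≤y : 0ℚ ≤ y
    0≤y = <⇒≤ 0<y

    0≤1-η : 0ℚ ≤ 1ℚ - η
    0≤1-η = subst (0ℚ ≤_) (trans
      (cong (λ j → 1ℚ - j * η + K1 * η) K2≡)
      (solve 2 (λ η k → con 1ℚ :- (k :+ con 1ℚ) :* η :+ k :* η := con 1ℚ :- η) refl η K1))
      (p≤q⇒0≤q-p K2η≤1 ⊕ 0≤toℚ (suc k) ⊗ 0≤η)

    -- The worst case is y = r + 1, where (r+1)η ≤ 1 still leaves r. This is where y ≥ r + 1 enters
    -- rather than y ≥ r.
    K1≤z : K1 ≤ z
    K1≤z = ≤-by
      (p≤q⇒0≤q-p (subst (_≤ y) K2≡ K2≤y) ⊗ 0≤1-η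
        ⊕ p≤q⇒0≤q-p (subst (λ j → j * η ≤ 1ℚ) K2≡ K2η≤1))
      (solve 3 (λ y η k → y :- η :* y :- k :=
         (y :- (k :+ con 1ℚ)) :* (con 1ℚ :- η) :+ (con 1ℚ :- (k :+ con 1ℚ) :* η)) refl y η K1)

    B-nonNeg : 0ℚ ≤ B
    B-nonNeg = ff-nonNeg k (p≤p+1 (pred-≤ k K1≤y))

    -- `ff-ratio` with s = (k+2)η: the shift ηy is at most s(y - k) because y ≥ k + 2. The resulting
    -- 1 - ks is then weakened to 1 - θ.
    c≥ : (1ℚ - θ) * B ≤ c
    c≥ = ≤-trans
      (≤-by (0≤toℚ (suc (suc k)) ⊗ 0≤η ⊗ B-nonNeg)
        (trans (cong (λ j → (1ℚ - toℚ k * (K2 * η)) * B - (1ℚ - j * K2 * η) * B) (toℚ-suc k))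
          (solve 4 (λ k l η b → (con 1ℚ :- k :* (l :* η)) :* b
             :- (con 1ℚ :- (k :+ con 1ℚ) :* l :* η) :* b := l :* η :* b) refl (toℚ k) K2 η B)))
      (ff-ratio k (0≤toℚ (suc (suc k)) ⊗ 0≤η) K2η≤1 (p≤p+1 (pred-≤ k K1≤y))
        (≤-by (0≤η ⊗ (0≤toℚ (suc (suc k)) ⊕ p≤q⇒0≤q-p K2≤y ⊗ 0≤toℚ (suc k)))
          (trans (cong₂ (λ i j → i * η * (y - 1ℚ + 1ℚ - toℚ k) - (y - 1ℚ - (y - η * y - 1ℚ)))
                   (trans K2≡ (cong (_+ 1ℚ) (toℚ-suc k))) K2≡)
            (trans (solve 3 (λ y η k →
                (k :+ con 1ℚ :+ con 1ℚ) :* η :* (y :- con 1ℚ :+ con 1ℚ :- k)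
                  :- (y :- con 1ℚ :- (y :- η :* y :- con 1ℚ))
                := η :* ((k :+ con 1ℚ :+ con 1ℚ) :+ (y :- (k :+ con 1ℚ :+ con 1ℚ)) :* (k :+ con 1ℚ)))
                refl y η (toℚ k))
              (sym (cong₂ (λ i j → η * (i + (y - i) * j))
                (trans K2≡ (cong (_+ 1ℚ) (toℚ-suc k))) (toℚ-suc k)))))))

    P≤yB : a * K1 * m ≤ y * B
    P≤yB = subst₂ (λ p q → p * m ≤ q) (trans (toℚ-! k) (*-comm K1 a)) (ff-shift y k) sized

    Rich : Fin (order G) → Set
    Rich v = ¬ (a * toℚ (deg v) < c)

    rich? : Decidable Rich
    rich? v = ¬? (a * toℚ (deg v) <? c)

    L : Subset (order G)
    L = comprehension rich?

    S : Subset (order G)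
    S = proj₁ (nestedSubset L κ≤n)

    deficit : ∀ v → 0ℚ ≤ (y - K1) * toℚ (deg v) - K1 * toℚ (cdeg v)
    deficit v = p≤q⇒0≤q-p (cliqueDegree-bound k G y K1≤y sized v)

    -- K(v) ≤ |G| - d(v) and r! |G| ≤ yB, so each unit of scaled degree above B costs y in the
    -- scaled deficit.
    deficit-excess : ∀ v → 0ℚ ≤ a * ((y - K1) * toℚ (deg v) - K1 * toℚ (cdeg v)) + y * B
                              - y * (a * toℚ (deg v))
    deficit-excess v = subst (0ℚ ≤_)
      (solve 7 (λ a y d b m c k → (y :* b :- a :* k :* m) :+ a :* k :* (m :- (c :+ d))
         := a :* ((y :- k) :* d :- k :* c) :+ y :* b :- y :* (a :* d)) refl
         a y (toℚ (deg v)) B m (toℚ (cdeg v)) K1)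
      (p≤q⇒0≤q-p P≤yB ⊕ 0≤a ⊗ 0≤toℚ (suc k) ⊗ p≤q⇒0≤q-p
        (subst (_≤ m) (toℚ-+ (cdeg v) (deg v)) (toℚ-mono-≤ (cliqueDegree+degree≤size G v))))

    -- The link argument with z in place of y; since y - z = ηy, every edge at a poor vertex leaves
    -- a deficit of at least ηy.
    deficit-poor : ∀ v → a * toℚ (deg v) < c →
                   K1 * toℚ (cdeg v) ≤ (z - K1) * toℚ (deg v)
    deficit-poor v poor = ≤-trans
      (*-monoˡ-≤-nonNeg K1 ⦃ nonNegative (0≤toℚ (suc k)) ⦄ (toℚ-mono-≤ (cliqueDegree≤link G v)))
      (subst₂ (λ d e → K1 * toℚ (cliqueCount (link G v)) ≤ e * toℚ d)
        (size-link G v)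
        (trans (solve 2 (λ y k → y :- con 1ℚ :- k := y :- (k :+ con 1ℚ)) refl z (toℚ k))
               (cong (λ j → z - j) (sym (toℚ-suc k))))
        (clique-bound k (link G v) (z - 1ℚ) (pred-≤ k K1≤z)
          (subst (λ d → a * toℚ d < c) (sym (size-link G v)) poor)))

    out : Fin (order G) → ℕ
    out v = 𝟙 (¬? (v ∈? S)) ℕ.* deg v

    -- A vertex outside S pays ηy for each of its edges out of its deficit. A rich vertex may be
    -- unable to do so; it lies in `L ─ S` and receives the allowance ηyB.
    vertex-inequality : ∀ v → η * y * a * toℚ (out v) + a * K1 * toℚ (cdeg v)
      ≤ a * (y - K1) * toℚ (deg v) + η * y * B * toℚ (𝟙 (v ∈? (L ─ S)))
    vertex-inequality v with v ∈? S
    ... | yes v∈S = ≤-by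
      (0≤a ⊗ deficit v ⊕ 0≤η ⊗ 0≤y ⊗ B-nonNeg ⊗ 0≤toℚ (𝟙 (v ∈? (L ─ S))))
      (trans (cong (λ o → a * (y - K1) * d + η * y * B * w - (η * y * a * o + a * K1 * e)) toℚ-0)
        (solve 8 (λ a y η b k d e w →
          a :* (y :- k) :* d :+ η :* y :* b :* w :- (η :* y :* a :* con 0ℚ :+ a :* k :* e)
          := a :* ((y :- k) :* d :- k :* e) :+ η :* y :* b :* w) refl a y η B K1 d e w))
      where
      d = toℚ (deg v)
      e = toℚ (cdeg v)
      w = toℚ (𝟙 (v ∈? (L ─ S)))
    ... | no v∉S with a * toℚ (deg v) <? c
    ... | yes poor = ≤-by
      (0≤a ⊗ p≤q⇒0≤q-p (deficit-poor v poor) ⊕ 0≤η ⊗ 0≤y ⊗ B-nonNeg ⊗ 0≤toℚ (𝟙 (v ∈? (L ─ S))))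
      (trans (cong (λ o → a * (y - K1) * d + η * y * B * w - (η * y * a * toℚ o + a * K1 * e))
               (ℕ.*-identityˡ (deg v)))
        (solve 8 (λ a y η b k d e w →
          a :* (y :- k) :* d :+ η :* y :* b :* w :- (η :* y :* a :* d :+ a :* k :* e)
          := a :* ((y :- η :* y :- k) :* d :- k :* e) :+ η :* y :* b :* w) refl a y η B K1 d e w))
      where
      d = toℚ (deg v)
      e = toℚ (cdeg v)
      w = toℚ (𝟙 (v ∈? (L ─ S)))
    -- A convex combination of `deficit` and `deficit-excess` with weights 1 - η and η.
    ... | no rich = ≤-by
      (0≤1-η ⊗ (0≤a ⊗ deficit v) ⊕ 0≤η ⊗ deficit-excess v)
      (trans (cong₂ (λ o w → a * (y - K1) * d + η * y * B * w - (η * y * a * toℚ o + a * K1 * e))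
               (ℕ.*-identityˡ (deg v))
               (trans (cong toℚ (𝟙-yes (v ∈? (L ─ S))
                 (x∈p∧x∉q⇒x∈p─q (∈-comprehension⁺ rich? rich) v∉S))) toℚ-1))
        (solve 7 (λ a y η b k d e →
          a :* (y :- k) :* d :+ η :* y :* b :* con 1ℚ :- (η :* y :* a :* d :+ a :* k :* e)
          := (con 1ℚ :- η) :* (a :* ((y :- k) :* d :- k :* e))
             :+ η :* (a :* ((y :- k) :* d :- k :* e) :+ y :* b :- y :* (a :* d))) refl
          a y η B K1 d e))
      where
      d = toℚ (deg v)
      e = toℚ (cdeg v)

    -- Each vertex of `L` has scaled degree at least c, and all degrees together sum to r |G|.
    cN≤P : c * toℚ ∣ L ∣ ≤ a * K1 * m
    cN≤P = subst₂ _≤_ (cong (λ n → c * toℚ n) (∑𝟙-∈ L))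
      (trans (cong (λ n → a * n) (trans (cong toℚ (handshake (edge? G) (suc k) (uniform G)))
                                        (toℚ-* (suc k) (size G))))
             (sym (*-assoc a K1 m)))
      (sum-scaled (λ v → 𝟙 (v ∈? L)) deg c a bound)
      where
      bound : ∀ v → c * toℚ (𝟙 (v ∈? L)) ≤ a * toℚ (deg v)
      bound v with v ∈? L
      ... | yes v∈L = subst (_≤ a * toℚ (deg v))
        (sym (trans (cong (λ n → c * n) toℚ-1) (*-identityʳ c)))
        (≮⇒≥ (∈-comprehension⁻ rich? v∈L))
      ... | no _ = subst (_≤ a * toℚ (deg v))
        (sym (trans (cong (λ n → c * n) toℚ-0) (*-zeroʳ c))) (0≤a ⊗ 0≤toℚ (deg v))

    surplus : B * toℚ ∣ L ─ S ∣ ≤ toℚ 4 * θ * (a * K1 * m)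
    surplus with ∣ L ∣ ℕ.≤? κ
    ... | yes N≤κ = subst (_≤ toℚ 4 * θ * (a * K1 * m))
      (sym (trans (cong (λ n → B * n)
        (trans (cong toℚ (trans (proj₂ (proj₂ (nestedSubset L κ≤n))) (ℕ.m≤n⇒m∸n≡0 N≤κ))) toℚ-0))
        (*-zeroʳ B)))
      (0≤toℚ 4 ⊗ 0≤θ ⊗ (0≤a ⊗ 0≤toℚ (suc k) ⊗ 0≤toℚ (size G)))
    -- From (1-θ)BN ≤ P ≤ yB ≤ (κ+θ)B and N ≥ 1 follows B(N-κ) ≤ 2θBN, and θ ≤ 1/2 gives BN ≤ 2P;
    -- together this is the constant 4.
    ... | no N≰κ = ≤-by
      (two ⊗ 0≤θ ⊗ (two ⊗ P-BN ⊕ p≤q⇒0≤q-p (subst (λ t → t * θ ≤ 1ℚ) toℚ-2 θ≤½) ⊗ (B-nonNeg ⊗ 0≤toℚ ∣ L ∣))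
       ⊕ (B-nonNeg ⊗ p≤q⇒0≤q-p y≤κ+θ ⊕ p≤q⇒0≤q-p P≤yB ⊕ P-BN
         ⊕ 0≤θ ⊗ B-nonNeg ⊗ p≤q⇒0≤q-p (subst (_≤ N) toℚ-1 (toℚ-mono-≤ 1≤N))))
      (trans (cong₂ (λ f w → f * θ * P - B * w) toℚ-4 W≡)
        (solve 6 (λ b n y κ θ p →
          (con 1ℚ :+ con 1ℚ :+ con 1ℚ :+ con 1ℚ) :* θ :* p :- b :* (n :- κ)
          := (con 1ℚ :+ con 1ℚ) :* θ :* ((con 1ℚ :+ con 1ℚ) :* (p :- (con 1ℚ :- θ) :* b :* n)
               :+ (con 1ℚ :- (con 1ℚ :+ con 1ℚ) :* θ) :* (b :* n))
             :+ (b :* (κ :+ θ :- y) :+ (y :* b :- p) :+ (p :- (con 1ℚ :- θ) :* b :* n)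
               :+ θ :* b :* (n :- con 1ℚ))) refl B N y (toℚ κ) θ P))
      where
      N P : ℚ
      N = toℚ ∣ L ∣
      P = a * K1 * m
      1≤N : 1 ℕ.≤ ∣ L ∣
      1≤N = ℕ.≤-trans (ℕ.s≤s ℕ.z≤n) (ℕ.≰⇒> N≰κ)
      two : 0ℚ ≤ 1ℚ + 1ℚ
      two = 0≤1 ⊕ 0≤1
      toℚ-2 : toℚ 2 ≡ 1ℚ + 1ℚ
      toℚ-2 = trans (toℚ-suc 1) (cong (_+ 1ℚ) toℚ-1)
      toℚ-4 : toℚ 4 ≡ 1ℚ + 1ℚ + 1ℚ + 1ℚ
      toℚ-4 = trans (toℚ-suc 3) (cong (_+ 1ℚ) (trans (toℚ-suc 2) (cong (_+ 1ℚ) toℚ-2)))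
      W≡ : toℚ ∣ L ─ S ∣ ≡ N - toℚ κ
      W≡ = trans
        (solve 2 (λ w κ → w := κ :+ w :- κ) refl (toℚ ∣ L ─ S ∣) (toℚ κ))
        (cong (λ n → n - toℚ κ) (trans (sym (toℚ-+ κ ∣ L ─ S ∣))
          (cong toℚ (trans (cong (κ ℕ.+_) (proj₂ (proj₂ (nestedSubset L κ≤n))))
                           (ℕ.m+[n∸m]≡n (ℕ.<⇒≤ (ℕ.≰⇒> N≰κ)))))))
      P-BN : 0ℚ ≤ P - (1ℚ - θ) * B * N
      P-BN = p≤q⇒0≤q-p (≤-trans
        (*-monoʳ-≤-nonNeg N ⦃ nonNegative (0≤toℚ ∣ L ∣) ⦄ c≥) cN≤P)

    -- In the sum of the vertex inequalities, `many` bounds the total deficit by δ(y-r)r|G|, hence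
    -- by δyr|G|, and `surplus` bounds the allowances. The common factor k! y then cancels.
    out≤ : η * toℚ (sum out) ≤ K1 * (δ + toℚ 4 * η * θ) * m
    out≤ = ≤-by (*-cancel-0≤ (0<* (0<toℚ-! k) 0<y) (subst (0ℚ ≤_)
        (solve 12 (λ a y η b k m l c w x δ q →
          (a :* (y :- k) :* (k :* m) :+ η :* y :* b :* w
             :- (η :* y :* a :* x :+ a :* k :* (l :* c)))
          :+ a :* k :* (l :* c :- (con 1ℚ :- δ) :* (y :- k) :* m)
          :+ a :* k :* δ :* (k :* m)
          :+ η :* y :* (q :* (a :* k :* m) :- b :* w)
          := a :* y :* (k :* (δ :+ η :* q) :* m :- η :* x)) refl
          a y η B K1 m K2 (toℚ (cliqueCount G)) (toℚ ∣ L ─ S ∣) (toℚ (sum out)) δ (toℚ 4 * θ))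
        (p≤q⇒0≤q-p summed
          ⊕ 0≤a ⊗ 0≤toℚ (suc k) ⊗ p≤q⇒0≤q-p many
          ⊕ 0≤a ⊗ 0≤toℚ (suc k) ⊗ 0≤δ ⊗ (0≤toℚ (suc k) ⊗ 0≤toℚ (size G))
          ⊕ 0≤η ⊗ 0≤y ⊗ p≤q⇒0≤q-p surplus)))
      (solve 7 (λ k δ f η θ m x → k :* (δ :+ f :* η :* θ) :* m :- x
                  := k :* (δ :+ η :* (f :* θ)) :* m :- x) refl
        K1 δ (toℚ 4) η θ m (η * toℚ (sum out)))
      where
      summed : η * y * a * toℚ (sum out) + a * K1 * (K2 * toℚ (cliqueCount G))
               ≤ a * (y - K1) * (K1 * m) + η * y * B * toℚ ∣ L ─ S ∣
      summed = subst₂ _≤_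
        (cong (λ t → η * y * a * toℚ (sum out) + a * K1 * t)
          (trans (cong toℚ (handshake (isClique? G) (suc (suc k)) λ (∣T∣ , _) → ∣T∣))
                 (toℚ-* (suc (suc k)) (cliqueCount G))))
        (cong₂ (λ t u → a * (y - K1) * t + η * y * B * u)
          (trans (cong toℚ (handshake (edge? G) (suc k) (uniform G))) (toℚ-* (suc k) (size G)))
          (cong toℚ (∑𝟙-∈ (L ─ S))))
        (sum-linear out cdeg deg (λ v → 𝟙 (v ∈? (L ─ S)))
          (η * y * a) (a * K1) (a * (y - K1)) (η * y * B) vertex-inequality)

    conclusion : ∃[ S ] ∣ S ∣ ≡ κ ×
      η * toℚ (edgesNotWithin G S) ≤ K1 * (δ + toℚ 4 * η * θ) * m
    conclusion = S , proj₁ (proj₂ (nestedSubset L κ≤n)) , ≤-trans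
      (*-monoˡ-≤-nonNeg η ⦃ nonNegative 0≤η ⦄ (toℚ-mono-≤ (edgesNotWithin≤ G S))) out≤

-- Locating the ceiling and choosing the constants

module Approximation where

  open import Data.Fin.Subset using (Subset; ∣_∣)
  open import Data.Fin.Subset.Properties using (∣p∣≤n)
  import Data.Integer.Base as ℤ
  import Data.Integer.Properties as ℤ
  open import Data.Nat.Base as ℕ using (ℕ; zero; suc; _!)
  import Data.Nat.Properties as ℕ
  open import Data.Product.Base using (∃-syntax; _×_; _,_)
  open import Data.Rational.Base hiding (∣_∣)
  open import Data.Rational.Properties
  open import Data.Rational.Solver using (module +-*-Solver)
  import Data.Rational.Unnormalised.Base as ℚᵘ
  import Data.Rational.Unnormalised.Properties as ℚᵘ
  open import Relation.Binary.PropositionalEquality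
  open import Relation.Nullary
  open +-*-Solver
  open Hypergraph
  open Counting
  open Rationals
  open KruskalKatona
  open Stability

  Σ⊆-0 : ∀ n → Σ⊆ {n} (λ _ → 0) ≡ 0
  Σ⊆-0 zero    = refl
  Σ⊆-0 (suc n) = cong₂ ℕ._+_ (Σ⊆-0 n) (Σ⊆-0 n)

  -- Pascal's rule multiplied by (r+1)!.
  ff-pascal : ∀ q r → ff (q + 1ℚ) (suc r) ≡ toℚ (suc r) * ff q r + ff q (suc r)
  ff-pascal q r = trans (ff-shift (q + 1ℚ) r) (trans
    (cong (λ p → (q + 1ℚ) * ff p r) (solve 1 (λ q → q :+ con 1ℚ :- con 1ℚ := q) refl q))
    (trans (solve 3 (λ q r f → (q :+ con 1ℚ) :* f := (r :+ con 1ℚ) :* f :+ f :* (q :- r)) refl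
             q (toℚ r) (ff q r))
           (cong (λ j → j * ff q r + ff q (suc r)) (sym (toℚ-suc r)))))

  subsets-of-size : ∀ n r → toℚ (r !) * toℚ (Σ⊆ {n} (λ s → 𝟙 (∣ s ∣ ℕ.≟ r))) ≡ ff (toℚ n) r
  subsets-of-size zero zero rewrite toℚ-1 = refl
  subsets-of-size zero (suc r) = trans
    (trans (cong (λ t → toℚ (suc r !) * t) toℚ-0) (*-zeroʳ (toℚ (suc r !))))
    (sym (trans (ff-shift (toℚ 0) r)
      (trans (cong (λ t → t * ff (toℚ 0 - 1ℚ) r) toℚ-0) (*-zeroˡ (ff (toℚ 0 - 1ℚ) r)))))
  subsets-of-size (suc n) zero rewrite Σ⊆-0 n = subsets-of-size n zero
  subsets-of-size (suc n) (suc r) = begin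
    toℚ (suc r !) * toℚ (M ℕ.+ N)
      ≡⟨ cong (λ t → toℚ (suc r !) * t) (toℚ-+ M N) ⟩
    toℚ (suc r !) * (toℚ M + toℚ N)
      ≡⟨ *-distribˡ-+ (toℚ (suc r !)) (toℚ M) (toℚ N) ⟩
    toℚ (suc r !) * toℚ M + toℚ (suc r !) * toℚ N
      ≡⟨ cong₂ _+_ (trans (cong (λ t → t * toℚ M) (toℚ-! r))
                          (*-assoc (toℚ (suc r)) (toℚ (r !)) (toℚ M)))
                   (subsets-of-size n (suc r)) ⟩
    toℚ (suc r) * (toℚ (r !) * toℚ M) + ff (toℚ n) (suc r)
      ≡⟨ cong (λ t → toℚ (suc r) * t + ff (toℚ n) (suc r)) (subsets-of-size n r) ⟩
    toℚ (suc r) * ff (toℚ n) r + ff (toℚ n) (suc r)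
      ≡⟨ sym (ff-pascal (toℚ n) r) ⟩
    ff (toℚ n + 1ℚ) (suc r)
      ≡⟨ cong (λ q → ff q (suc r)) (sym (toℚ-suc n)) ⟩
    ff (toℚ (suc n)) (suc r) ∎
    where
    open ≡-Reasoning
    M N : ℕ
    M = Σ⊆ {n} (λ s → 𝟙 (∣ s ∣ ℕ.≟ r))
    N = Σ⊆ {n} (λ s → 𝟙 (∣ s ∣ ℕ.≟ suc r))

  size≤ff-order : ∀ {r} (G : Hypergraph r) → toℚ (r !) * toℚ (size G) ≤ ff (toℚ (order G)) r
  size≤ff-order {r} G = subst (toℚ (r !) * toℚ (size G) ≤_)
    (trans (cong (λ n → toℚ (r !) * toℚ n) (count≡Σ⊆ {order G} (λ s → ∣ s ∣ ℕ.≟ r)))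
           (subsets-of-size (order G) r))
    (*-monoˡ-≤-nonNeg (toℚ (r !)) ⦃ nonNegative (0≤toℚ (r !)) ⦄
      (toℚ-mono-≤ (count-mono (edge? G) (λ s → ∣ s ∣ ℕ.≟ r) (uniform G))))

  order<r⇒size≡0 : ∀ {r} (G : Hypergraph r) → order G ℕ.< r → size G ≡ 0
  order<r⇒size≡0 G n<r = ℕ.n≤0⇒n≡0 (subst₂ ℕ._≤_ (sym (count≡Σ⊆ (edge? G))) (Σ⊆-0 (order G))
    (Σ⊆-mono λ e → 𝟙≤ (edge? G e) λ Ee →
      contradiction (subst (ℕ._≤ order G) (uniform G Ee) (∣p∣≤n e)) (ℕ.<⇒≱ n<r)))

  ff-diagonal : ∀ r → ff (toℚ r) r ≡ toℚ (r !)
  ff-diagonal zero = sym toℚ-1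
  ff-diagonal (suc r) = trans (ff-shift (toℚ (suc r)) r) (trans
    (cong (λ f → toℚ (suc r) * f) (trans (cong (λ q → ff q r) (toℚ-suc-∸ r)) (ff-diagonal r)))
    (sym (toℚ-! r)))

  ff-subdiagonal : ∀ k → ff (toℚ (suc (suc k))) (suc k) ≡ toℚ (suc k !) * toℚ (suc (suc k))
  ff-subdiagonal k = begin
    ff (toℚ (suc (suc k))) (suc k)
      ≡⟨ ff-shift (toℚ (suc (suc k))) k ⟩
    toℚ (suc (suc k)) * ff (toℚ (suc (suc k)) - 1ℚ) k
      ≡⟨ cong (λ q → toℚ (suc (suc k)) * ff q k) (toℚ-suc-∸ (suc k)) ⟩
    toℚ (suc (suc k)) * f
      ≡⟨ *-comm (toℚ (suc (suc k))) f ⟩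
    f * toℚ (suc (suc k))
      ≡⟨ cong (_* toℚ (suc (suc k))) (trans
           (trans (solve 2 (λ f k → f := f :* (k :+ con 1ℚ :- k)) refl f (toℚ k))
                  (cong (λ j → f * (j - toℚ k)) (sym (toℚ-suc k))))
           (ff-diagonal (suc k))) ⟩
    toℚ (suc k !) * toℚ (suc (suc k)) ∎
    where
    open ≡-Reasoning
    f = ff (toℚ (suc k)) k

  -- For |G| ≤ C(r+1,r) = r+1 the clique bound with y = r + 1 reads (r+1)K ≤ |G|, as y - r = 1.
  -- Otherwise |G| exceeds r + 1 anyway.
  k+2≤size : ∀ {k} (G : Hypergraph (suc k)) → 1 ℕ.≤ cliqueCount G →
             toℚ (suc (suc k)) ≤ toℚ (size G)
  k+2≤size {k} G 1≤K with toℚ (suc k !) * toℚ (size G) ≤? ff (toℚ (suc (suc k))) (suc k)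
  ... | yes small = ≤-trans
    (≤-by (0≤toℚ (suc (suc k)) ⊗ p≤q⇒0≤q-p (subst (_≤ toℚ (cliqueCount G)) toℚ-1 (toℚ-mono-≤ 1≤K)))
      (solve 2 (λ k c → k :* c :- k := k :* (c :- con 1ℚ)) refl
        (toℚ (suc (suc k))) (toℚ (cliqueCount G))))
    (subst (toℚ (suc (suc k)) * toℚ (cliqueCount G) ≤_)
      (trans (cong (λ j → (j - toℚ (suc k)) * toℚ (size G)) (toℚ-suc (suc k)))
        (solve 2 (λ k m → (k :+ con 1ℚ :- k) :* m := m) refl (toℚ (suc k)) (toℚ (size G))))
      (cliqueCount-bound k G (toℚ (suc (suc k))) (toℚ-mono-≤ (ℕ.n≤1+n (suc k))) small))
  ... | no large = *-cancelˡ-≤-pos (toℚ (suc k !)) ⦃ positive (0<toℚ-! (suc k)) ⦄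
    (subst (_≤ toℚ (suc k !) * toℚ (size G)) (ff-subdiagonal k) (<⇒≤ (≰⇒> large)))

  -- With P = r! |G| the result says i < x ≤ i + 1. Searching through rational values finds the
  -- ceiling without comparing reals.
  crossing : ∀ {r} {P : ℚ} j d → ff (toℚ j) r < P → P ≤ ff (toℚ (d ℕ.+ j)) r →
    ∃[ i ] j ℕ.≤ i × i ℕ.< d ℕ.+ j × ff (toℚ i) r < P × P ≤ ff (toℚ (suc i)) r
  crossing j zero below above = contradiction (<-≤-trans below above) (<-irrefl refl)
  crossing {r} {P} j (suc d) below above with ff (toℚ (d ℕ.+ j)) r <? P
  ... | yes below′ = d ℕ.+ j , ℕ.m≤n+m j d , ℕ.≤-refl , below′ , above
  ... | no ¬below =
    let i , j≤i , i<d+j , lo , hi = crossing {r} {P} j d below (≮⇒≥ ¬below)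
    in i , j≤i , ℕ.m≤n⇒m≤1+n i<d+j , lo , hi

  ff-reflects-≤ : ∀ {k n p t P} → k ℕ.≤ n → 0ℚ ≤ t → P ≤ ff (toℚ n) (suc k) →
                  ff p (suc k) ≤ P + t → p ≤ toℚ n + t
  ff-reflects-≤ {k} {n} {p} {t} {P} k≤n 0≤t P≤ f≤ with p ≤? toℚ n
  ... | yes p≤n = ≤-by (p≤q⇒0≤q-p p≤n ⊕ 0≤t)
    (solve 3 (λ p n t → n :+ t :- p := n :- p :+ t) refl p (toℚ n) t)
  ... | no p≰n = ≤-by
    (p≤q⇒0≤q-p (≤-trans (ff-growth k (toℚ-mono-≤ k≤n) (<⇒≤ (≰⇒> p≰n))) f≤) ⊕ p≤q⇒0≤q-p P≤)
    (solve 5 (λ p n t P g → n :+ t :- p := P :+ t :- (g :+ (p :- n)) :+ (g :- P)) refl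
      p (toℚ n) t P (ff (toℚ n) (suc k)))

  -- The strict order on the reals asks for a fixed margin h. Let g be the gap from `ff` at i up to
  -- P. If p ≤ i, the value at p misses P by at least g, but only g/2 is allowed. If i < p < i + h,
  -- the ratio bound lets the value rise above that at i by at most rh(P+1) ≤ g/4, although it must
  -- rise by g/2.
  ff-reflects-< : ∀ {k i p h P} → suc k ℕ.≤ i → 0ℚ ≤ P → 0ℚ < P - ff (toℚ i) (suc k) →
    toℚ (suc k) ≤ p + 1ℚ → (ℤ.+ 2 / 1) * (P - ff p (suc k)) ≤ P - ff (toℚ i) (suc k) →
    ff p (suc k) ≤ P + 1ℚ → 0ℚ ≤ h → h ≤ 1ℚ →
    (ℤ.+ 4 / 1) * (toℚ (suc k) * (P + 1ℚ)) * h ≤ P - ff (toℚ i) (suc k) →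
    toℚ i + h ≤ p
  ff-reflects-< {k} {i} {p} {h} {P} k<i 0≤P 0<g K1≤p+1 near f≤ 0≤h h≤1 small = ≮⇒≥ absurd
    where
    f g₀ : ℚ
    f  = ff p (suc k)
    g₀ = ff (toℚ i) (suc k)
    absurd : ¬ (p < toℚ i + h)
    absurd p<i+h with p ≤? toℚ i
    ... | yes p≤i = <-irrefl refl (<-≤-trans
      (0<⊕ 0<g (p≤q⇒0≤q-p near))
      (≤-by (nonNegative⁻¹ (ℤ.+ 2 / 1) ⊗ p≤q⇒0≤q-p (ff-mono (suc k) K1≤p+1 p≤i))
        (solve 3 (λ P f g → con 0ℚ :- (P :- g :+ (P :- g :- con (ℤ.+ 2 / 1) :* (P :- f)))
           := con (ℤ.+ 2 / 1) :* (g :- f)) refl P f g₀)))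
    ... | no p≰i = <-irrefl refl (<-≤-trans
      (0<⊕ 0<g (p≤q⇒0≤q-p near ⊕ p≤q⇒0≤q-p near ⊕ p≤q⇒0≤q-p small
        ⊕ nonNegative⁻¹ (ℤ.+ 4 / 1) ⊗ (0≤toℚ (suc k) ⊗ 0≤h ⊗ p≤q⇒0≤q-p f≤)))
      (≤-by (nonNegative⁻¹ (ℤ.+ 4 / 1) ⊗ p≤q⇒0≤q-p (ff-ratio (suc k) 0≤h h≤1 K1≤p+1 close))
        (solve 5 (λ P f g j h → con 0ℚ :- (P :- g :+ ((P :- g :- con (ℤ.+ 2 / 1) :* (P :- f))
             :+ (P :- g :- con (ℤ.+ 2 / 1) :* (P :- f))
             :+ (P :- g :- con (ℤ.+ 4 / 1) :* (j :* (P :+ con 1ℚ)) :* h)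
             :+ con (ℤ.+ 4 / 1) :* (j :* h :* (P :+ con 1ℚ :- f))))
           := con (ℤ.+ 4 / 1) :* (g :- (con 1ℚ :- j :* h) :* f)) refl P f g₀ (toℚ (suc k)) h)))
      where
      -- As p > i ≥ r, the smallest factor p + 1 - r is at least 1, so h times it covers p - i < h.
      close : p - toℚ i ≤ h * (p + 1ℚ - toℚ (suc k))
      close = ≤-by
        (p≤q⇒0≤q-p (<⇒≤ p<i+h)
          ⊕ 0≤h ⊗ (p≤q⇒0≤q-p (<⇒≤ (≰⇒> p≰i))
            ⊕ p≤q⇒0≤q-p (toℚ-mono-≤ k<i)))
        (solve 4 (λ p i h j → h :* (p :+ con 1ℚ :- j) :- (p :- i)
           := i :+ h :- p :+ h :* (p :- i :+ (i :- j))) refl p (toℚ i) h (toℚ (suc k)))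

  opaque
    recip : ∀ n → .⦃ ℕ.NonZero n ⦄ → ℚ
    recip n = ℤ.+ 1 / n

    recip-def : ∀ n .⦃ _ : ℕ.NonZero n ⦄ → recip n ≡ ℤ.+ 1 / n
    recip-def n = refl

    0<recip : ∀ n .⦃ _ : ℕ.NonZero n ⦄ → 0ℚ < recip n
    0<recip n = positive⁻¹ (ℤ.+ 1 / n) ⦃ normalize-pos 1 n ⦄

    *-recip : ∀ n .⦃ _ : ℕ.NonZero n ⦄ → toℚ n * recip n ≡ 1ℚ
    *-recip (suc n) = toℚᵘ-injective (ℚᵘ.≃-trans (toℚᵘ-homo-* (toℚ (suc n)) (ℤ.+ 1 / suc n))
      (ℚᵘ.≃-trans (ℚᵘ.*-cong
          (subst (λ q → toℚᵘ q ℚᵘ.≃ ℚᵘ.mkℚᵘ (ℤ.+ suc n) 0) (sym (toℚ-def (suc n)))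
            (toℚᵘ-fromℚᵘ (ℚᵘ.mkℚᵘ (ℤ.+ suc n) 0)))
          (toℚᵘ-fromℚᵘ (ℚᵘ.mkℚᵘ (ℤ.+ 1) n)))
        (ℚᵘ.*≡* (trans (ℤ.*-identityʳ (ℤ.+ suc n ℤ.* ℤ.+ 1))
           (trans (ℤ.*-identityʳ (ℤ.+ suc n))
             (sym (trans (ℤ.*-identityˡ (ℤ.+ (1 ℕ.* suc n))) (cong ℤ.+_ (ℕ.*-identityˡ (suc n))))))))))

  -- η = e / (8(r+1)³) makes θ at most 1/2, and δ = η² is of the same order as ηθ. The loss r(δ +
  -- 4ηθ) = rη²(1 + 4r(r+1)) of `Core` is then at most ηe.
  module Tolerances (k : ℕ) (e : ℚ) (0<e : 0ℚ < e) (e≤1 : e ≤ 1ℚ) where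

    j q η δ θ : ℚ
    j = toℚ (suc k)
    q = recip (8 ℕ.* (suc (suc k) ℕ.* (suc (suc k) ℕ.* suc (suc k))))
    η = e * q
    δ = η * η
    θ = j * toℚ (suc (suc k)) * η

    0≤e : 0ℚ ≤ e
    0≤e = <⇒≤ 0<e

    0≤j : 0ℚ ≤ j
    0≤j = 0≤toℚ (suc k)

    0<q : 0ℚ < q
    0<q = 0<recip (8 ℕ.* (suc (suc k) ℕ.* (suc (suc k) ℕ.* suc (suc k))))

    0≤q : 0ℚ ≤ q
    0≤q = <⇒≤ 0<q

    0<η : 0ℚ < η
    0<η = 0<* 0<e 0<q

    0≤η : 0ℚ ≤ η
    0≤η = <⇒≤ 0<η

    0<δ : 0ℚ < δ
    0<δ = 0<* 0<η 0<η

    lit : ∀ n → 0ℚ ≤ ℤ.+ n / 1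
    lit n = subst (0ℚ ≤_) (toℚ-def n) (0≤toℚ n)

    K2≡ : toℚ (suc (suc k)) ≡ j + 1ℚ
    K2≡ = toℚ-suc (suc k)

    -- Writing 1 in this way turns the differences below into polynomials in j, q, e and 1 - e
    -- with nonnegative coefficients.
    unit : (ℤ.+ 8 / 1) * ((j + 1ℚ) * ((j + 1ℚ) * (j + 1ℚ))) * q ≡ 1ℚ
    unit = trans (cong (_* q) (sym (trans (toℚ-* 8 (s ℕ.* (s ℕ.* s))) (cong₂ _*_ (toℚ-def 8)
        (trans (toℚ-* s (s ℕ.* s)) (cong₂ _*_ K2≡ (trans (toℚ-* s s) (cong₂ _*_ K2≡ K2≡))))))))
      (*-recip (8 ℕ.* (s ℕ.* (s ℕ.* s))))
      where s = suc (suc k)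

    K2η≤1 : toℚ (suc (suc k)) * η ≤ 1ℚ
    K2η≤1 = ≤-by
      (0≤q ⊗ (0≤j ⊕ 0≤1) ⊗ (p≤q⇒0≤q-p e≤1 ⊕ lit 8 ⊗ (0≤j ⊗ 0≤j) ⊕ lit 16 ⊗ 0≤j ⊕ lit 7))
      (trans (cong₂ (λ u v → u - v * η) (sym unit) K2≡)
        (solve 3 (λ e q j → con (ℤ.+ 8 / 1) :* ((j :+ con 1ℚ) :* ((j :+ con 1ℚ) :* (j :+ con 1ℚ))) :* q
             :- (j :+ con 1ℚ) :* (e :* q)
           := q :* (j :+ con 1ℚ) :* (con 1ℚ :- e :+ con (ℤ.+ 8 / 1) :* (j :* j)
                :+ con (ℤ.+ 16 / 1) :* j :+ con (ℤ.+ 7 / 1))) refl e q j))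

    θ≤½ : toℚ 2 * θ ≤ 1ℚ
    θ≤½ = ≤-by
      (0≤q ⊗ (0≤j ⊕ 0≤1) ⊗ (lit 2 ⊗ 0≤j ⊗ p≤q⇒0≤q-p e≤1 ⊕ lit 8 ⊗ (0≤j ⊗ 0≤j) ⊕ lit 14 ⊗ 0≤j ⊕ lit 8))
      (trans (cong₂ (λ u v → u - v) (sym unit) (cong₂ (λ t v → t * (j * v * η)) (toℚ-def 2) K2≡))
        (solve 3 (λ e q j → con (ℤ.+ 8 / 1) :* ((j :+ con 1ℚ) :* ((j :+ con 1ℚ) :* (j :+ con 1ℚ))) :* q
             :- con (ℤ.+ 2 / 1) :* (j :* (j :+ con 1ℚ) :* (e :* q))
           := q :* (j :+ con 1ℚ) :* (con (ℤ.+ 2 / 1) :* j :* (con 1ℚ :- e)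
                :+ con (ℤ.+ 8 / 1) :* (j :* j) :+ con (ℤ.+ 14 / 1) :* j :+ con (ℤ.+ 8 / 1))) refl e q j))

    loss≤ : j * (δ + toℚ 4 * η * θ) ≤ η * e
    loss≤ = ≤-by
      (0≤η ⊗ 0≤e ⊗ 0≤q ⊗ (lit 4 ⊗ (0≤j ⊗ (0≤j ⊗ 0≤j)) ⊕ lit 20 ⊗ (0≤j ⊗ 0≤j) ⊕ lit 23 ⊗ 0≤j ⊕ lit 8))
      (trans (cong₂ (λ u v → u - v)
          (trans (sym (*-identityʳ (η * e))) (cong (λ u → η * e * u) (sym unit)))
          (cong₂ (λ t v → j * (δ + t * η * (j * v * η))) (toℚ-def 4) K2≡))
        (solve 3 (λ e q j →
           e :* q :* e :* (con (ℤ.+ 8 / 1) :* ((j :+ con 1ℚ) :* ((j :+ con 1ℚ) :* (j :+ con 1ℚ))) :* q)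
             :- j :* (e :* q :* (e :* q) :+ con (ℤ.+ 4 / 1) :* (e :* q) :* (j :* (j :+ con 1ℚ) :* (e :* q)))
           := e :* q :* e :* q :* (con (ℤ.+ 4 / 1) :* (j :* (j :* j)) :+ con (ℤ.+ 20 / 1) :* (j :* j)
                :+ con (ℤ.+ 23 / 1) :* j :+ con (ℤ.+ 8 / 1))) refl e q j))

    δ≤1 : δ ≤ 1ℚ
    δ≤1 = ≤-by ((0≤1 ⊕ 0≤η) ⊗ (p≤q⇒0≤q-p K2η≤1 ⊕ 0≤j ⊗ 0≤η))
      (trans (solve 2 (λ j η → con 1ℚ :- η :* η
           := (con 1ℚ :+ η) :* (con 1ℚ :- (j :+ con 1ℚ) :* η :+ j :* η)) refl j η)
        (cong (λ v → (1ℚ + η) * (1ℚ - v * η + j * η)) (sym K2≡)))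

    0<θ : 0ℚ < θ
    0<θ = 0<* (0<* (0<toℚ-suc k) (0<toℚ-suc (suc k))) 0<η

    -- p is a rational approximation of x, accurate to within t, and y = p + t.
    module Approximant (G : Hypergraph (suc k)) (p t s : ℚ) where

      F P K m f y : ℚ
      F = toℚ (suc k !)
      m = toℚ (size G)
      P = F * m
      K = toℚ (cliqueCount G)
      f = ff p (suc k)
      y = p + t

      0≤P : 0ℚ ≤ P
      0≤P = 0≤toℚ (suc k !) ⊗ 0≤toℚ (size G)

      -- `s` is the slack supplied by the strict hypothesis on cliques; t is small enough for `s` to
      -- absorb every rounding error.
      module Bounds
        (0<t : 0ℚ < t) (t≤1 : t ≤ 1ℚ) (K1≤y : j ≤ y)
        (f≥ : P - t ≤ f) (f≤ : f ≤ P + t)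
        (cliques : (1ℚ - δ) * (f * (p - j)) + s ≤ toℚ (suc (suc k)) * (F * K))
        (t-small : (ℤ.+ 3 / 1) * (t * (P + 1ℚ)) ≤ s)
        where

        0≤t : 0ℚ ≤ t
        0≤t = <⇒≤ 0<t

        k≤p : toℚ k ≤ p
        k≤p = ≤-by (p≤q⇒0≤q-p (subst (_≤ y) (toℚ-suc k) K1≤y) ⊕ p≤q⇒0≤q-p t≤1)
          (solve 3 (λ p t k → p :- k := p :+ t :- (k :+ con 1ℚ) :+ (con 1ℚ :- t)) refl p t (toℚ k))

        f≤P+1 : f ≤ P + 1ℚ
        f≤P+1 = ≤-trans f≤ (+-monoʳ-≤ P t≤1)

        -- The reason for y = p + t: the value at p may fall short of P by t, and moving the
        -- argument up by t gains at least t.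
        sized : P ≤ ff y (suc k)
        sized = ≤-trans
          (≤-by (p≤q⇒0≤q-p f≥)
            (solve 4 (λ P f p t → f :+ (p :+ t :- p) :- P := f :- (P :- t)) refl P f p t))
          (ff-growth k k≤p (≤-by 0≤t (solve 2 (λ p t → p :+ t :- p := t) refl p t)))

        -- Growth from k, where the falling factorial is nonnegative, gives p - k ≤ f ≤ P + t.
        y-K1≤P+1 : y - j ≤ P + 1ℚ
        y-K1≤P+1 = ≤-by
          (p≤q⇒0≤q-p (≤-trans (ff-growth k ≤-refl k≤p) f≤)
            ⊕ ff-nonNeg {toℚ k} (suc k) (≤-reflexive (toℚ-suc k))
            ⊕ lit 2 ⊗ p≤q⇒0≤q-p t≤1)
          (trans (cong (λ i → P + 1ℚ - (p + t - i)) (toℚ-suc k))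
            (solve 5 (λ P p t k g → P :+ con 1ℚ :- (p :+ t :- (k :+ con 1ℚ))
              := P :+ t :- (g :+ (p :- k)) :+ g :+ con (ℤ.+ 2 / 1) :* (con 1ℚ :- t)) refl
              P p t (toℚ k) (ff (toℚ k) (suc k))))

        -- Passing from f(p-r) to P(y-r) costs (y-r)(P-f) + tf, at most 2t(P+1). Of the available
        -- 3t(P+1) one share remains and makes the inequality strict.
        many-strict : (1ℚ - δ) * (y - j) * P < toℚ (suc (suc k)) * (F * K)
        many-strict = <-by
          (0<⊕ (0<* 0<t (+-mono-≤-< 0≤P (positive⁻¹ 1ℚ)))
            (p≤q⇒0≤q-p cliques ⊕ p≤q⇒0≤q-p t-small
             ⊕ p≤q⇒0≤q-p δ≤1 ⊗ (p≤q⇒0≤q-p K1≤y ⊗ p≤q⇒0≤q-p f≥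
                 ⊕ 0≤t ⊗ p≤q⇒0≤q-p y-K1≤P+1 ⊕ 0≤t ⊗ p≤q⇒0≤q-p f≤P+1)
             ⊕ <⇒≤ 0<δ ⊗ (lit 2 ⊗ (0≤t ⊗ (0≤P ⊕ 0≤1)))))
          (solve 8 (λ X P f p t s δ j →
            X :- (con 1ℚ :- δ) :* (p :+ t :- j) :* P
            := t :* (P :+ con 1ℚ)
               :+ ((X :- ((con 1ℚ :- δ) :* (f :* (p :- j)) :+ s))
               :+ (s :- con (ℤ.+ 3 / 1) :* (t :* (P :+ con 1ℚ)))
               :+ (con 1ℚ :- δ) :* ((p :+ t :- j) :* (f :- (P :- t))
                    :+ t :* (P :+ con 1ℚ :- (p :+ t :- j)) :+ t :* (P :+ con 1ℚ :- f))
               :+ δ :* (con (ℤ.+ 2 / 1) :* (t :* (P :+ con 1ℚ))))) refl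
            (toℚ (suc (suc k)) * (F * K)) P f p t s δ j)

        -- The left side of `many-strict` is nonnegative, so strictness rules out K = 0.
        1≤K : 1 ℕ.≤ cliqueCount G
        1≤K = ℕ.n≢0⇒n>0 λ K≡0 → <-irrefl refl (≤-<-trans
          (p≤q⇒0≤q-p δ≤1 ⊗ p≤q⇒0≤q-p K1≤y ⊗ 0≤P)
          (subst ((1ℚ - δ) * (y - j) * P <_)
            (trans (cong (λ n → toℚ (suc (suc k)) * (F * n)) (trans (cong toℚ K≡0) toℚ-0))
              (solve 2 (λ a b → a :* (b :* con 0ℚ) := con 0ℚ) refl (toℚ (suc (suc k))) F))
            many-strict))

        many : (1ℚ - δ) * (y - j) * m ≤ toℚ (suc (suc k)) * K
        many = ≤-by (*-cancel-0≤ (0<toℚ-! (suc k)) (subst (0ℚ ≤_)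
            (solve 7 (λ F m K l δ y j → l :* (F :* K) :- (con 1ℚ :- δ) :* (y :- j) :* (F :* m)
               := F :* (l :* K :- (con 1ℚ :- δ) :* (y :- j) :* m)) refl
               F m K (toℚ (suc (suc k))) δ y j)
            (p≤q⇒0≤q-p (<⇒≤ many-strict)))) refl

        K2≤m : toℚ (suc (suc k)) ≤ m
        K2≤m = k+2≤size G 1≤K

        FK2≤P : F * toℚ (suc (suc k)) ≤ P
        FK2≤P = *-monoˡ-≤-nonNeg F ⦃ nonNegative (0≤toℚ (suc k !)) ⦄ K2≤m

        -- The hypothesis x ≥ r alone is too weak for `Core`. A clique exists, so |G| ≥ r + 1 =
        -- C(r+1,r), and growth of the falling factorial forces y ≥ r + 1.
        K2≤y : toℚ (suc (suc k)) ≤ y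
        K2≤y = ≮⇒≥ λ y<K2 → <-irrefl refl (<-≤-trans
          (<-by {ff y (suc k)} {F * toℚ (suc (suc k))}
            (0<⊕ (p<q⇒0<q-p y<K2) (p≤q⇒0≤q-p (ff-growth k (suc≤⇒≤ k K1≤y) (<⇒≤ y<K2))))
            (trans (cong (_- ff y (suc k)) (sym (ff-subdiagonal k)))
              (solve 4 (λ a b l y → a :- b := l :- y :+ (a :- (b :+ (l :- y)))) refl
                (ff (toℚ (suc (suc k))) (suc k)) (ff y (suc k)) (toℚ (suc (suc k))) y)))
          (≤-trans FK2≤P sized))

        F<P : ff (toℚ (suc k)) (suc k) < P
        F<P = <-≤-trans
          (subst (_< F * toℚ (suc (suc k))) (sym (ff-diagonal (suc k)))
            (<-by {F} (0<* (0<toℚ-! (suc k)) (0<toℚ-suc k))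
              (trans (cong (λ l → F * l - F) K2≡)
                (solve 2 (λ F j → F :* (j :+ con 1ℚ) :- F := F :* j) refl F j))))
          FK2≤P

        -- `suc i` will be the ceiling of x. The search runs from r up to the order of G, which also
        -- ensures that G has enough vertices for S.
        roundUp : ∃[ i ] suc k ℕ.≤ i × suc i ℕ.≤ order G ×
                  ff (toℚ i) (suc k) < P × P ≤ ff (toℚ (suc i)) (suc k)
        roundUp = let i , k<i , i<n , lo , hi = crossing {suc k} {P} (suc k) (order G ℕ.∸ suc k) F<P
                        (subst (λ n → P ≤ ff (toℚ n) (suc k)) (sym n≡) (size≤ff-order G))
                  in i , k<i , subst (i ℕ.<_) n≡ i<n , lo , hi
          where
          k<n : suc k ℕ.≤ order G
          k<n = ℕ.≮⇒≥ λ n<r → <-irrefl refl (<-≤-trans (0<toℚ-suc (suc k))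
            (≤-trans K2≤m (≤-reflexive (trans (cong toℚ (order<r⇒size≡0 G n<r)) toℚ-0))))
          n≡ : (order G ℕ.∸ suc k) ℕ.+ suc k ≡ order G
          n≡ = ℕ.m∸n+n≡m k<n

        nearly-all : (ℤ.+ 2 / 1) * t ≤ θ →
          ∃[ S ] (∃[ i ] ∣ S ∣ ≡ suc i × suc k ℕ.≤ i ×
             ff (toℚ i) (suc k) < P × P ≤ ff (toℚ (suc i)) (suc k)) ×
          toℚ (edgesNotWithin G S) ≤ e * m
        nearly-all 2t≤θ =
          let i , k<i , i<n , lo , hi = roundUp
              S , ∣S∣ , few = Core.conclusion G y η δ (suc i) K2≤y sized 0<η K2η≤1 (<⇒≤ 0<δ)
                                many θ≤½ (y≤κ+θ i k<i hi) i<n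
          in S , (i , ∣S∣ , k<i , lo , hi) , ≤-by
            (*-cancel-0≤ 0<η (subst (0ℚ ≤_)
              (solve 5 (λ η E e m l → l :* m :- η :* E :+ (η :* e :- l) :* m := η :* (e :* m :- E)) refl
                η (toℚ (edgesNotWithin G S)) e m (j * (δ + toℚ 4 * η * θ)))
              (p≤q⇒0≤q-p few ⊕ p≤q⇒0≤q-p loss≤ ⊗ 0≤toℚ (size G)))) refl
          where
          y≤κ+θ : ∀ i → suc k ℕ.≤ i → P ≤ ff (toℚ (suc i)) (suc k) → y ≤ toℚ (suc i) + θ
          -- Both p and y = p + t contribute an error t, hence the requirement 2t ≤ θ.
          y≤κ+θ i k<i hi = ≤-by
            (p≤q⇒0≤q-p (ff-reflects-≤ (ℕ.m≤n⇒m≤1+n (ℕ.<⇒≤ k<i)) 0≤t hi f≤) ⊕ p≤q⇒0≤q-p 2t≤θ)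
            (solve 4 (λ p t n θ → n :+ θ :- (p :+ t)
               := n :+ t :- p :+ (θ :- con (ℤ.+ 2 / 1) :* t)) refl p t (toℚ (suc i)) θ)

-- From one good approximation to Cauchy sequences

module Sequences where

  open import Data.Fin.Subset using (∣_∣)
  import Data.Integer.Base as ℤ
  open import Data.Nat.Base as ℕ using (ℕ; zero; suc; _!)
  import Data.Nat.Properties as ℕ
  open import Data.Product.Base using (∃-syntax; _×_; _,_; proj₁; proj₂)
  open import Data.Rational.Base as ℚ hiding (∣_∣)
  open import Data.Rational.Properties
  open import Data.Rational.Solver using (module +-*-Solver)
  open import Data.Sum.Base using (inj₁; inj₂)
  open import Relation.Binary.PropositionalEquality
  open +-*-Solver
  open Hypergraph
  open Counting
  open Rationals
  open Approximation

  Eventually : (ℕ → Set) → Set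
  Eventually P = ∃[ N ] (∀ {n} → N ℕ.≤ n → P n)

  infixr 4 _∧ᵉ_

  _∧ᵉ_ : ∀ {P Q} → Eventually P → Eventually Q → Eventually λ n → P n × Q n
  (M , p) ∧ᵉ (N , q) = M ℕ.⊔ N , λ h → p (ℕ.m⊔n≤o⇒m≤o M N h) , q (ℕ.m⊔n≤o⇒n≤o M N h)

  mapᵉ : ∀ {P Q} → (∀ n → P n → Q n) → Eventually P → Eventually Q
  mapᵉ f (N , p) = N , λ h → f _ (p h)

  fraction : ∀ N .⦃ _ : ℕ.NonZero N ⦄ {g} → 0ℚ < g →
             ∃[ h ] 0ℚ < h × h ≤ 1ℚ × toℚ N * h ≤ g
  fraction N {g} 0<g = 1ℚ ⊓ (g * recip N) ,
    0<⊓ (positive⁻¹ 1ℚ) (0<* 0<g (0<recip N)) , p⊓q≤p 1ℚ (g * recip N) ,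
    ≤-trans
      (*-monoˡ-≤-nonNeg (toℚ N) ⦃ nonNegative (0≤toℚ N) ⦄ (p⊓q≤q 1ℚ (g * recip N)))
      (≤-reflexive (trans (solve 3 (λ n g r → n :* (g :* r) := g :* (n :* r)) refl (toℚ N) g (recip N))
        (trans (cong (g *_) (*-recip N)) (*-identityʳ g))))

  p≤∣p∣ : ∀ p → p ≤ ℚ.∣ p ∣
  p≤∣p∣ p with ≤-total 0ℚ p
  ... | inj₁ 0≤p = ≤-reflexive (sym (0≤p⇒∣p∣≡p 0≤p))
  ... | inj₂ p≤0 = ≤-trans p≤0 (0≤∣p∣ p)

  ∣p-q∣≤⇒ : ∀ {p q t} → ℚ.∣ p - q ∣ ≤ t → p ≤ q + t × q ≤ p + t
  ∣p-q∣≤⇒ {p} {q} {t} h =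
    ≤-by (p≤q⇒0≤q-p (≤-trans (p≤∣p∣ (p - q)) h))
      (solve 3 (λ p q t → q :+ t :- p := t :- (p :- q)) refl p q t) ,
    ≤-by (p≤q⇒0≤q-p (≤-trans (p≤∣p∣ (- (p - q)))
        (subst (_≤ t) (sym (∣-p∣≡∣p∣ (p - q))) h)))
      (solve 3 (λ p q t → p :+ t :- q := t :- (:- (p :- q))) refl p q t)

  scale-up : ∀ {F i f m t} → F * i ≡ 1ℚ → 0ℚ ≤ F →
    m ≤ f * i + t * i × f * i ≤ m + t * i → F * m - t ≤ f × f ≤ F * m + t
  scale-up {F} {i} {f} {m} {t} Fi≡1 0≤F (lo , hi) =
    ≤-by (0≤F ⊗ p≤q⇒0≤q-p lo)
      (trans (cong₂ (λ f t → f - (F * m - t)) (grow f) (grow t))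
        (solve 5 (λ F i f m t → F :* i :* f :- (F :* m :- F :* i :* t)
          := F :* (f :* i :+ t :* i :- m)) refl F i f m t)) ,
    ≤-by (0≤F ⊗ p≤q⇒0≤q-p hi)
      (trans (cong₂ (λ f t → F * m + t - f) (grow f) (grow t))
        (solve 5 (λ F i f m t → F :* m :+ F :* i :* t :- F :* i :* f
          := F :* (m :+ t :* i :- f :* i)) refl F i f m t))
    where
    grow : ∀ q → q ≡ F * i * q
    grow q = sym (trans (cong (_* q) Fi≡1) (*-identityˡ q))

  clear-denominator : ∀ {D i g s K δ} → D * i ≡ 1ℚ → 0ℚ ≤ D →
    (1ℚ - δ) * (g * i) + s ≤ K → (1ℚ - δ) * g + D * s ≤ D * K
  clear-denominator {D} {i} {g} {s} {K} {δ} Di≡1 0≤D h = ≤-by (0≤D ⊗ p≤q⇒0≤q-p h)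
    (trans (cong (λ g → D * K - ((1ℚ - δ) * g + D * s))
        (sym (trans (cong (_* g) Di≡1) (*-identityˡ g))))
      (solve 6 (λ D i g s K δ → D :* K :- ((con 1ℚ :- δ) :* (D :* i :* g) :+ D :* s)
        := D :* (K :- ((con 1ℚ :- δ) :* (g :* i) :+ s))) refl D i g s K δ))

  -- Replacing m by b costs et, and e ≤ 1 keeps this within t.
  approximate-product : ∀ {E e e′ b m t} → 0ℚ ≤ e → e ≤ 1ℚ → e ≤ e′ → 0ℚ ≤ b → 0ℚ ≤ t →
    m ≤ b + t → E ≤ e * m → E ≤ e′ * b + t
  approximate-product {E} {e} {e′} {b} {m} {t} 0≤e e≤1 e≤e′ 0≤b 0≤t m≤ E≤ = ≤-by
    (p≤q⇒0≤q-p e≤e′ ⊗ 0≤b ⊕ 0≤e ⊗ p≤q⇒0≤q-p m≤ ⊕ 0≤t ⊗ p≤q⇒0≤q-p e≤1 ⊕ p≤q⇒0≤q-p E≤)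
    (solve 6 (λ E e e′ b m t → e′ :* b :+ t :- E
      := (e′ :- e) :* b :+ e :* (b :+ t :- m) :+ t :* (con 1ℚ :- e) :+ (e :* m :- E)) refl
      E e e′ b m t)

  module _ (k : ℕ) (e : ℚ) (0<e : 0ℚ < e) (e≤1 : e ≤ 1ℚ) where

    open Tolerances k e 0<e e≤1

    -- A single sufficiently accurate term of the sequence determines S. The ceiling property
    -- concerns all late terms; it follows from the position of P between the values at i and i + 1,
    -- which does not depend on the term.
    stability : (G : Hypergraph (suc k)) (x : ℕ → ℚ) (s : ℚ) → 0ℚ < s →
      (∀ t → 0ℚ < t → Eventually λ n → toℚ (suc k) ≤ x n + t) →
      (∀ t → 0ℚ < t → Eventually λ n →
        toℚ (suc k !) * toℚ (size G) - t ≤ ff (x n) (suc k) ×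
        ff (x n) (suc k) ≤ toℚ (suc k !) * toℚ (size G) + t) →
      (Eventually λ n → (1ℚ - δ) * (ff (x n) (suc k) * (x n - toℚ (suc k))) + s
        ≤ toℚ (suc (suc k)) * (toℚ (suc k !) * toℚ (cliqueCount G))) →
      ∃[ S ] ((∃[ h ] 0ℚ < h × Eventually λ n → (toℚ ∣ S ∣ - 1ℚ) + h ≤ x n)
        × (∀ t → 0ℚ < t → Eventually λ n → x n ≤ toℚ ∣ S ∣ + t))
        × toℚ (edgesNotWithin G S) ≤ e * toℚ (size G)
    stability G x s 0<s r≤x sized cliques =
      let S , (i , ∣S∣≡ , k<i , lo , hi) , few = nearly-all 2t≤θ
      in S , (above ∣S∣≡ k<i (p<q⇒0<q-p lo) , below ∣S∣≡ k<i hi) , few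
      where
      F P : ℚ
      F = toℚ (suc k !)
      P = F * toℚ (size G)

      c : ℕ
      -- P + 1 as a natural number, so that `fraction` can divide by it.
      c = suc (suc k ! ℕ.* size G)

      c≡ : toℚ c ≡ P + 1ℚ
      c≡ = trans (toℚ-suc (suc k ! ℕ.* size G)) (cong (_+ 1ℚ) (toℚ-* (suc k !) (size G)))

      t₁ = fraction (3 ℕ.* c) 0<s
      t₂ = fraction 2 0<θ

      t : ℚ
      t = proj₁ t₁ ⊓ proj₁ t₂

      0<t : 0ℚ < t
      0<t = 0<⊓ (proj₁ (proj₂ t₁)) (proj₁ (proj₂ t₂))

      t≤t₁ = p⊓q≤p (proj₁ t₁) (proj₁ t₂)
      t≤t₂ = p⊓q≤q (proj₁ t₁) (proj₁ t₂)

      t-small : (ℤ.+ 3 / 1) * (t * (P + 1ℚ)) ≤ s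
      t-small = ≤-trans
        (≤-reflexive (trans (solve 3 (λ a t p → a :* (t :* p) := a :* p :* t) refl (ℤ.+ 3 / 1) t (P + 1ℚ))
          (cong (_* t) (sym (trans (toℚ-* 3 c) (cong₂ _*_ (toℚ-def 3) c≡))))))
        (≤-trans (*-monoˡ-≤-nonNeg (toℚ (3 ℕ.* c)) ⦃ nonNegative (0≤toℚ (3 ℕ.* c)) ⦄ t≤t₁)
                 (proj₂ (proj₂ (proj₂ t₁))))

      2t≤θ : (ℤ.+ 2 / 1) * t ≤ θ
      2t≤θ = ≤-trans (*-monoˡ-≤-nonNeg (ℤ.+ 2 / 1) {t} {proj₁ t₂} t≤t₂)
        (subst (λ l → l * proj₁ t₂ ≤ θ) (toℚ-def 2) (proj₂ (proj₂ (proj₂ t₂))))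

      good = r≤x t 0<t ∧ᵉ sized t 0<t ∧ᵉ cliques

      at = proj₂ good {proj₁ good} ℕ.≤-refl

      open Approximant G (x (proj₁ good)) t s using (module Bounds; 0≤P)
      open Bounds 0<t (≤-trans t≤t₁ (proj₁ (proj₂ (proj₂ t₁)))) (proj₁ at)
        (proj₁ (proj₁ (proj₂ at))) (proj₂ (proj₁ (proj₂ at))) (proj₂ (proj₂ at)) t-small
        using (nearly-all)

      below : ∀ {N i} → N ≡ suc i → suc k ℕ.≤ i → P ≤ ff (toℚ (suc i)) (suc k) →
              ∀ t → 0ℚ < t → Eventually λ n → x n ≤ toℚ N + t
      below refl k<i P≤ t 0<t = mapᵉ
        (λ n (_ , f≤) → ff-reflects-≤ (ℕ.m≤n⇒m≤1+n (ℕ.<⇒≤ k<i)) (<⇒≤ 0<t) P≤ f≤)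
        (sized t 0<t)

      above : ∀ {N i} → N ≡ suc i → suc k ℕ.≤ i → 0ℚ < P - ff (toℚ i) (suc k) →
              ∃[ h ] 0ℚ < h × Eventually λ n → (toℚ N - 1ℚ) + h ≤ x n
      above {i = i} refl k<i 0<gap =
        -- The two margins of `ff-reflects-<`: 4r(P+1)h and 2u are both at most the gap.
        let h , 0<h , h≤1 , h-small = fraction (4 ℕ.* (suc k ℕ.* c)) 0<gap
            u , 0<u , u≤1 , u-small = fraction 2 0<gap
        in h , 0<h , mapᵉ
          (λ n (K1≤x+1 , f≥ , f≤) → subst (λ q → q + h ≤ x n) (sym (toℚ-suc-∸ i))
            (ff-reflects-< {k} {i} {x n} {h} {P} k<i 0≤P 0<gap K1≤x+1
              (≤-trans
                (*-monoˡ-≤-nonNeg (ℤ.+ 2 / 1) {P - ff (x n) (suc k)} {u} (≤-by (p≤q⇒0≤q-p f≥)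
                  (solve 3 (λ P u f → u :- (P :- f) := f :- (P :- u)) refl P u (ff (x n) (suc k)))))
                (subst (λ l → l * u ≤ gap) (toℚ-def 2) u-small))
              (≤-trans f≤ (+-monoʳ-≤ P u≤1)) (<⇒≤ 0<h) h≤1
              (subst (λ l → l * h ≤ gap)
                (trans (toℚ-* 4 (suc k ℕ.* c)) (cong₂ _*_ (toℚ-def 4)
                  (trans (toℚ-* (suc k) c) (cong (toℚ (suc k) *_) c≡))))
                h-small)))
          (r≤x 1ℚ (positive⁻¹ 1ℚ) ∧ᵉ sized u 0<u)
        where
        gap : ℚ
        gap = P - ff (toℚ i) (suc k)

-- The theorem over the reals

open import Defs
open import Data.Nat.Base using (ℕ; zero; suc; _≥_; s≤s; _!)
open import Data.Fin.Subset using (∣_∣)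
open import Data.Product.Base using (∃-syntax; _×_; _,_; proj₁; proj₂)
import Data.Integer.Base as ℤ
import Data.Nat.Base as ℕ
import Data.Nat.Properties as ℕ
import Data.Rational.Base as ℚ
open ℚ using (ℚ; 0ℚ; 1ℚ)
import Data.Rational.Properties as ℚ
open import Relation.Binary.PropositionalEquality
open Hypergraph
open Rationals
open Approximation
open Sequences

approx-fallingFactorial : ∀ x k n → approx (fallingFactorial x k) n ≡ ff (approx x n) k
approx-fallingFactorial x zero    n = refl
approx-fallingFactorial x (suc k) n = cong₂ (λ f j → f ℚ.* (approx x n ℚ.- j))
  (approx-fallingFactorial x k n) (sym (toℚ-def k))

recip! : ℕ → ℚ
recip! k = recip (k !) ⦃ k ℕ.!≢0 ⦄

!*recip! : ∀ k → toℚ (k !) ℚ.* recip! k ≡ 1ℚ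
!*recip! k = *-recip (k !) ⦃ k ℕ.!≢0 ⦄

0<recip! : ∀ k → 0ℚ ℚ.< recip! k
0<recip! k = 0<recip (k !) ⦃ k ℕ.!≢0 ⦄

approx-binomial : ∀ x k n → approx (binomial x k) n ≡ ff (approx x n) k ℚ.* recip! k
approx-binomial x k n = cong₂ ℚ._*_ (approx-fallingFactorial x k n)
  (sym (recip-def (k !) ⦃ k ℕ.!≢0 ⦄))

module _ (k : ℕ) (ε : ℝ) (e : ℚ) (0<e : 0ℚ ℚ.< e) (e≤1 : e ℚ.≤ 1ℚ)
  (e≤ε : Eventually λ n → e ℚ.≤ approx ε n) where

  open Tolerances k e 0<e e≤1 using (δ; 0<δ)

  nearlyComplete : ∀ (G : Hypergraph (suc k)) (x : ℝ) → fromℕ (suc k) ≤ x →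
    fromℕ (size G) ≃ binomial x (suc k) →
    (1ℝ - fromℚ δ) * binomial x (suc (suc k)) < fromℕ (cliqueCount G) →
    ∃[ S ] IsCeiling x (∣_∣ {order G} S) ×
    fromℕ (edgesNotWithin G S) ≤ ε * binomial x (suc k)
  nearlyComplete G x r≤x size≃ (s , 0<s , cliques) =
    let S , ((h , 0<h , above) , below) , few =
          -- Multiplying the clique hypothesis by D = (r+1)! multiplies its slack s as well.
          stability k e 0<e e≤1 G (approx x) (D ℚ.* s) (0<* (0<toℚ-! (suc (suc k))) 0<s)
            r≤x′ sized (mapᵉ cliques′ cliques)
    in S ,
       ((h , 0<h , mapᵉ (λ n → subst (λ q → q ℚ.- 1ℚ ℚ.+ h ℚ.≤ approx x n) (toℚ-def ∣ S ∣)) above) ,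
        λ t 0<t → mapᵉ (λ n → subst (λ q → approx x n ℚ.≤ q ℚ.+ t) (toℚ-def ∣ S ∣)) (below t 0<t)) ,
       within S few
    where
    D i : ℚ
    D = toℚ (suc (suc k) !)
    i = recip! (suc k)

    r≤x′ : ∀ t → 0ℚ ℚ.< t → Eventually λ n → toℚ (suc k) ℚ.≤ approx x n ℚ.+ t
    r≤x′ t 0<t = mapᵉ (λ n → subst (ℚ._≤ approx x n ℚ.+ t) (sym (toℚ-def (suc k)))) (r≤x t 0<t)

    size≃′ : ∀ t → 0ℚ ℚ.< t → Eventually λ n →
      toℚ (size G) ℚ.≤ ff (approx x n) (suc k) ℚ.* i ℚ.+ t ×
      ff (approx x n) (suc k) ℚ.* i ℚ.≤ toℚ (size G) ℚ.+ t
    size≃′ t 0<t = mapᵉ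
      (λ n h → ∣p-q∣≤⇒ (subst₂ (λ p q → ℚ.∣ p ℚ.- q ∣ ℚ.≤ t)
        (sym (toℚ-def (size G))) (approx-binomial x (suc k) n) h))
      (size≃ t 0<t)

    sized : ∀ t → 0ℚ ℚ.< t → Eventually λ n →
      toℚ (suc k !) ℚ.* toℚ (size G) ℚ.- t ℚ.≤ ff (approx x n) (suc k) ×
      ff (approx x n) (suc k) ℚ.≤ toℚ (suc k !) ℚ.* toℚ (size G) ℚ.+ t
    sized t 0<t = mapᵉ (λ n → scale-up (!*recip! (suc k)) (0≤toℚ (suc k !)))
      (size≃′ (t ℚ.* i) (0<* 0<t (0<recip! (suc k))))

    within : ∀ S → toℚ (edgesNotWithin G S) ℚ.≤ e ℚ.* toℚ (size G) →
             fromℕ (edgesNotWithin G S) ≤ ε * binomial x (suc k)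
    within S few t 0<t = mapᵉ
      (λ n (e≤εₙ , K1≤x+1 , m≤ , _) → subst₂ (λ E b → E ℚ.≤ approx ε n ℚ.* b ℚ.+ t)
        (toℚ-def (edgesNotWithin G S)) (sym (approx-binomial x (suc k) n))
        (approximate-product {e = e} {approx ε n} {ff (approx x n) (suc k) ℚ.* i} {toℚ (size G)}
          (ℚ.<⇒≤ 0<e) e≤1 e≤εₙ
          (ff-nonNeg (suc k) K1≤x+1 ⊗ ℚ.<⇒≤ (0<recip! (suc k))) (ℚ.<⇒≤ 0<t) m≤ few))
      -- Tolerance 1 in r ≤ x suffices for the falling factorial to be nonnegative.
      (e≤ε ∧ᵉ r≤x′ 1ℚ (ℚ.positive⁻¹ 1ℚ) ∧ᵉ size≃′ t 0<t)

    cliques′ : ∀ n →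
      (1ℚ ℚ.- δ) ℚ.* approx (binomial x (suc (suc k))) n ℚ.+ s ℚ.≤ ℤ.+ cliqueCount G ℚ./ 1 →
      (1ℚ ℚ.- δ) ℚ.* (ff (approx x n) (suc k) ℚ.* (approx x n ℚ.- toℚ (suc k))) ℚ.+ D ℚ.* s
        ℚ.≤ toℚ (suc (suc k)) ℚ.* (toℚ (suc k !) ℚ.* toℚ (cliqueCount G))
    cliques′ n h = subst ((1ℚ ℚ.- δ) ℚ.* g ℚ.+ D ℚ.* s ℚ.≤_)
      (trans (cong (ℚ._* toℚ (cliqueCount G)) (toℚ-! (suc k)))
        (ℚ.*-assoc (toℚ (suc (suc k))) (toℚ (suc k !)) (toℚ (cliqueCount G))))
      (clear-denominator {g = g} {δ = δ} (!*recip! (suc (suc k))) (0≤toℚ (suc (suc k) !))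
        (subst₂ (λ b K → (1ℚ ℚ.- δ) ℚ.* b ℚ.+ s ℚ.≤ K)
          (approx-binomial x (suc (suc k)) n) (sym (toℚ-def (cliqueCount G))) h))
      where
      g : ℚ
      g = ff (approx x n) (suc k) ℚ.* (approx x n ℚ.- toℚ (suc k))

theorem2 : ∀ (ε : ℝ) → 0ℝ < ε → ∀ (r : ℕ) → r ≥ 1 →
    ∃[ δ ] 0ℝ < δ ×
    (∀ (G : Hypergraph r) (x : ℝ) → fromℕ r ≤ x →
    fromℕ (size G) ≃ binomial x r →
    (1ℝ - δ) * binomial x (suc r) < fromℕ (cliqueCount G) →
    ∃[ S ] IsCeiling x (∣_∣ {order G} S) ×
    fromℕ (edgesNotWithin G S) ≤ ε * binomial x r)
theorem2 ε (e₀ , 0<e₀ , N₀ , ε≥) (suc k) (s≤s _) =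
  fromℚ δ , (δ , 0<δ , 0 , λ _ → ℚ.≤-reflexive (ℚ.+-identityˡ δ)) ,
  nearlyComplete k ε e 0<e e≤1 e≤ε
  where
  e : ℚ
  -- A rational lower bound for late terms of ε, capped at 1 as the choice of constants and the
  -- final rounding require.
  e = e₀ ℚ.⊓ 1ℚ

  0<e : 0ℚ ℚ.< e
  0<e = 0<⊓ 0<e₀ (ℚ.positive⁻¹ 1ℚ)

  e≤1 : e ℚ.≤ 1ℚ
  e≤1 = ℚ.p⊓q≤q e₀ 1ℚ

  e≤ε : Eventually λ n → e ℚ.≤ approx ε n
  e≤ε = N₀ , λ {n} h → ℚ.≤-trans (ℚ.p⊓q≤p e₀ 1ℚ)
    (subst (ℚ._≤ approx ε n) (ℚ.+-identityˡ e₀) (ε≥ h))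

  open Tolerances k e 0<e e≤1 using (δ; 0<δ)
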